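{- Let $p\ge4$, $k\ge p$, $b=2\lceil\frac{k-2}{p-2}\rceil$, $D=p(b-1)$, and let $\bar c=(c_1,\dots,c_b)$ be a 2-flat sequence of integers from $[0,2^{k-1}-1]$. Let $f=f_D\circ f_{D-1}\circ\dots\circ f_1$ where $f_i=Q_{((i-1)\bmod p)+1}$ for $i=1,\dots,D$. Then $f(\bar c)$ is flat.
   Context: Flat: $c_1\le\dots\le c_{2m}\le c_1+1$. 2-flat: $(c_1,c_3,\dots,c_{2m-1})$ and $(c_2,c_4,\dots,c_{2m})$ both flat. Let $h_s=2^{k-s-1}-1$ for $1\le s\le k-1$. Maps $\mathbb R^b\to\mathbb R^b$ (unmentioned coordinates unchanged): $cyc$: coordinate 1 becomes $\max(c_1,c_b-1)$, coordinate $b$ becomes $\min(c_1+1,c_b)$; $dec_{j,s}$ ($1\le j\le b/2$, $1\le s\le k-1$): coordinate $j$ becomes $\min(c_j,c_{b-j+1}+h_s)$, coordinate $b-j+1$ becomes $\max(c_j-h_s,c_{b-j+1})$; $mov_j$ ($1\le j\le b/2$): for $t\in\{j,b-j\}$ coordinate $t$ becomes $\min(c_t,c_{t+1})$, for $t\in\{j+1,b-j+1\}$ coordinate $t$ becomes $\max(c_{t-1},c_t)$. For $x=1,\dots,p$: $MV_x=\{mov_j:1\le j\le\frac{k-2}{p-2},\ x+j\equiv1\pmod p\}$, $DC_x=\{dec_{j,s}:1\le j\le b/2,\ (x+j)\bmod p\notin\{1,2\},\ s=(p-2)(j-1)-1+((x+j-1)\bmod p)\le k-1\}$; $Q_1=\{cyc\}\cup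 MV_1\cup DC_1$, $Q_x=MV_x\cup DC_x$ ($2\le x\le p$). The functions in one $Q_x$ modify pairwise disjoint coordinates, and $Q_x$ denotes the map obtained by composing all of them (in any order). -}

module Defs where

open import Data.Nat as ℕ using (ℕ; zero; suc; _+_; _*_; _∸_; _^_; _≡ᵇ_; _≤ᵇ_; _%_; _/_)
open import Data.Integer as ℤ using (ℤ; +_; _⊓_; _⊔_; _-_; 1ℤ)
open import Data.Bool using (Bool; true; false; if_then_else_; _∧_; _∨_; not)
open import Data.Product using (_×_)
open import Function using (id)

-- A sequence (c_1,…,c_b) of integers is modelled as a function ℕ → ℤ ;
-- only the coordinates 1..b are ever read or used.
Seq : Set
Seq = ℕ → ℤ

-- n mod q (only used with q = p ≥ 4)
_mod_ : ℕ → ℕ → ℕ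
n mod zero    = n
n mod (suc q) = n % suc q

-- ⌈ n / q ⌉ (only used with q = p - 2 ≥ 2)
ceilDiv : ℕ → ℕ → ℕ
ceilDiv n zero    = 0
ceilDiv n (suc q) = (n + q) / suc q

Flat : ℕ → Seq → Set
Flat n c = (∀ t → 1 ℕ.≤ t → t ℕ.< n → c t ℤ.≤ c (suc t)) × (c n ℤ.≤ c 1 ℤ.+ 1ℤ)

TwoFlat : ℕ → Seq → Set
TwoFlat b c = Flat (b / 2) (λ i → c (2 * i ∸ 1)) × Flat (b / 2) (λ i → c (2 * i))

h : (k s : ℕ) → ℕ
h k s = 2 ^ (k ∸ s ∸ 1) ∸ 1

cyc : (b : ℕ) → Seq → Seq
cyc b c t =
  if t ≡ᵇ 1 then c 1 ⊔ (c b - 1ℤ)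
  else if t ≡ᵇ b then (c 1 ℤ.+ 1ℤ) ⊓ c b
  else c t

dec : (b j : ℕ) (hs : ℕ) → Seq → Seq
dec b j hs c t =
  if t ≡ᵇ j then c j ⊓ (c (b + 1 ∸ j) ℤ.+ + hs)
  else if t ≡ᵇ (b + 1 ∸ j) then (c j - + hs) ⊔ c (b + 1 ∸ j)
  else c t

mov : (b j : ℕ) → Seq → Seq
mov b j c t =
  if (t ≡ᵇ j) ∨ (t ≡ᵇ (b ∸ j)) then c t ⊓ c (suc t)
  else if (t ≡ᵇ suc j) ∨ (t ≡ᵇ (b + 1 ∸ j)) then c (t ∸ 1) ⊔ c t
  else c t

bOf : (p k : ℕ) → ℕ
bOf p k = 2 * ceilDiv (k ∸ 2) (p ∸ 2)

DOf : (p k : ℕ) → ℕ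
DOf p k = p * (bOf p k ∸ 1)

sOf : (p x j : ℕ) → ℕ
sOf p x j = (p ∸ 2) * (j ∸ 1) + ((x + j ∸ 1) mod p) ∸ 1

inMV : (p k x j : ℕ) → Bool
inMV p k x j = (1 ≤ᵇ j) ∧ (j * (p ∸ 2) ≤ᵇ k ∸ 2) ∧ ((x + j) mod p ≡ᵇ 1 mod p)

inDC : (p k x j : ℕ) → Bool
inDC p k x j =
  (1 ≤ᵇ j) ∧ (j ≤ᵇ bOf p k / 2)
  ∧ not ((x + j) mod p ≡ᵇ 1) ∧ not ((x + j) mod p ≡ᵇ 2)
  ∧ (1 ≤ᵇ sOf p x j) ∧ (sOf p x j ≤ᵇ k ∸ 1)

stepJ : (p k x j : ℕ) → Seq → Seq
stepJ p k x j c =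
  (if inDC p k x j then dec (bOf p k) j (h k (sOf p x j)) else id)
  ((if inMV p k x j then mov (bOf p k) j else id) c)

stepsUpTo : (p k x n : ℕ) → Seq → Seq
stepsUpTo p k x zero    c = c
stepsUpTo p k x (suc n) c = stepJ p k x (suc n) (stepsUpTo p k x n c)

-- the map Q_x (cyc included iff x = 1); every member has index j ≤ b/2
Q : (p k x : ℕ) → Seq → Seq
Q p k x c = stepsUpTo p k x (bOf p k / 2) (if x ≡ᵇ 1 then cyc (bOf p k) c else c)

fUpTo : (p k n : ℕ) → Seq → Seq
fUpTo p k zero    c = c
fUpTo p k (suc i) c = Q p k ((i mod p) + 1) (fUpTo p k i c)

f : (p k : ℕ) → Seq → Seq
f p k = fUpTo p k (DOf p k)

-- Idea.  A flat sequence of length m is i ↦ ⌊(L + i)/m⌋, so a 2-flat sequence is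
-- c_t = φ(x_t) with φ(x) = ⌊(x + S)/b⌋ and integers satisfying x_{b+1-t} = - x_t.
-- Since φ is monotone and φ(x + b) = φ(x) + 1, it commutes with every map of the
-- network, which thereby acts on x_1, …, x_m alone (m = b/2): cyc reflects x_1 upwards
-- about - m, dec reflects x_j downwards about m h_s, mov_j sorts x_j and x_{j+1}, and
-- mov_m replaces x_m by min(x_m, - x_m).
-- Watch the carried values: in each period column 1 emits a value ≥ - m, which then
-- moves one column to the right every p - 1 steps and, since 2 h_s + 1 = h_{s-1}, is
-- kept in [- m, m h_s] by the decs it meets, so it ends in [- m, 0].  After m periods all
-- values are in [- m, 0]; from then on cyc and the decs are idle and the remaining
-- passes are those of bubble sort.  At time D the x_j are sorted in [- m, 0], and so
-- x_1 ≤ … ≤ x_b ≤ x_1 + b, which φ turns into flatness.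

module Submission where

open import Defs
open import Data.Bool using (true; false; if_then_else_)
import Data.Bool.Properties as Boolₚ
open import Data.Empty using (⊥-elim)
open import Data.Integer as ℤ using (ℤ; +_; 0ℤ; 1ℤ; -_; _⊓_; _⊔_; +≤+; +<+; _/ℕ_) renaming (_≤_ to _≤ℤ_; _<_ to _<ℤ_)
open import Data.Integer.DivMod using ([n/ℕd]*d≤n; n<s[n/ℕd]*d)
import Data.Integer.Properties as ℤₚ
import Data.Integer.Tactic.RingSolver as ℤ-Solver
open import Data.Nat as ℕ using (ℕ; zero; suc; _+_; _*_; _∸_; _^_; _≤_; _<_; _≡ᵇ_; _≤ᵇ_; z≤n; s≤s; NonZero; _/_; _%_)
open import Data.Nat.DivMod using (m≡m%n+[m/n]*n; m%n<n; %-distribˡ-+; m%n%n≡m%n; [m+kn]%n≡m%n; m<n⇒m%n≡m; n%n≡0; m/n*n≤m; m*n/n≡m; m*n%n≡0)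
import Data.Nat.Properties as ℕₚ
open import Data.Product using (_×_; _,_; proj₁; proj₂; ∃-syntax)
open import Data.Sum using (_⊎_; inj₁; inj₂)
open import Data.Unit using (tt)
open import Function using (id)
open import Relation.Binary.Definitions using (tri<; tri≈; tri>)
open import Relation.Binary.PropositionalEquality using (_≡_; _≢_; refl; sym; trans; cong; cong₂; subst; subst₂)
open import Relation.Nullary using (yes; no; ¬_)

≤-by : ∀ {u v x y} → u ≤ℤ v → v ℤ.- u ≡ y ℤ.- x → x ≤ℤ y
≤-by u≤v eq = ℤₚ.0≤i-j⇒j≤i (subst (0ℤ ≤ℤ_) eq (ℤₚ.i≤j⇒0≤j-i u≤v))

-- Reflections

foldUp : ℤ → ℤ → ℤ
foldUp μ x = x ⊔ (- x ℤ.- (μ ℤ.+ μ))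

foldDown : ℤ → ℤ → ℤ
foldDown η x = x ⊓ (- x ℤ.+ (η ℤ.+ η))

foldUp-lower : ∀ μ x → - μ ≤ℤ foldUp μ x
foldUp-lower μ x with ℤₚ.≤-total (- μ) x
... | inj₁ -μ≤x = ℤₚ.≤-trans -μ≤x (ℤₚ.i≤i⊔j _ _)
... | inj₂ x≤-μ = ℤₚ.≤-trans (≤-by x≤-μ (eq μ x)) (ℤₚ.i≤j⊔i x _)
  where
  eq : ∀ μ x → - μ ℤ.- x ≡ (- x ℤ.- (μ ℤ.+ μ)) ℤ.- (- μ)
  eq = ℤ-Solver.solve-∀

-- The interval from `- α - 2μ` to `α` is symmetric about `- μ`, so reflecting about `- μ` does not
-- leave it.
foldUp-upper : ∀ μ {α x} → - α ℤ.- (μ ℤ.+ μ) ≤ℤ x → x ≤ℤ α → foldUp μ x ≤ℤ α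
foldUp-upper μ {α} {x} l u = ℤₚ.⊔-lub u (≤-by l (eq μ α x))
  where
  eq : ∀ μ α x → x ℤ.- (- α ℤ.- (μ ℤ.+ μ)) ≡ α ℤ.- (- x ℤ.- (μ ℤ.+ μ))
  eq = ℤ-Solver.solve-∀

foldUp-id : ∀ μ {x} → - μ ≤ℤ x → foldUp μ x ≡ x
foldUp-id μ {x} l = ℤₚ.i≥j⇒i⊔j≡i (≤-by (ℤₚ.+-mono-≤ l l) (eq μ x))
  where
  eq : ∀ μ x → (x ℤ.+ x) ℤ.- (- μ ℤ.+ - μ) ≡ x ℤ.- (- x ℤ.- (μ ℤ.+ μ))
  eq = ℤ-Solver.solve-∀

foldDown-upper : ∀ η x → foldDown η x ≤ℤ η
foldDown-upper η x with ℤₚ.≤-total x η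
... | inj₁ x≤η = ℤₚ.≤-trans (ℤₚ.i⊓j≤i _ _) x≤η
... | inj₂ η≤x = ℤₚ.≤-trans (ℤₚ.i⊓j≤j x _) (≤-by η≤x (eq η x))
  where
  eq : ∀ η x → x ℤ.- η ≡ η ℤ.- (- x ℤ.+ (η ℤ.+ η))
  eq = ℤ-Solver.solve-∀

-- Reflection about `η` exchanges `2η + μ` and `- μ`.
foldDown-lower : ∀ η {μ x} → - μ ≤ℤ x → x ≤ℤ (η ℤ.+ η) ℤ.+ μ → - μ ≤ℤ foldDown η x
foldDown-lower η {μ} {x} l u = ℤₚ.⊓-glb l (≤-by u (eq η μ x))
  where
  eq : ∀ η μ x → ((η ℤ.+ η) ℤ.+ μ) ℤ.- x ≡ (- x ℤ.+ (η ℤ.+ η)) ℤ.- (- μ)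
  eq = ℤ-Solver.solve-∀

foldDown-id : ∀ {η x} → 0ℤ ≤ℤ η → x ≤ℤ 0ℤ → foldDown η x ≡ x
foldDown-id {η} {x} 0≤η x≤0 = ℤₚ.i≤j⇒i⊓j≡i
  (≤-by (ℤₚ.+-mono-≤ (ℤₚ.+-mono-≤ x≤0 x≤0) (ℤₚ.+-mono-≤ 0≤η 0≤η)) (eq η x))
  where
  eq : ∀ η x → ((0ℤ ℤ.+ 0ℤ) ℤ.+ (η ℤ.+ η)) ℤ.- ((x ℤ.+ x) ℤ.+ (0ℤ ℤ.+ 0ℤ)) ≡ (- x ℤ.+ (η ℤ.+ η)) ℤ.- x
  eq = ℤ-Solver.solve-∀

-- The lowest reflected value is `2η - α`, which is at least `- α - 2μ` because `η` and `μ` are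
-- nonnegative.
foldDown-lower′ : ∀ {η μ α x} → 0ℤ ≤ℤ η → 0ℤ ≤ℤ μ → - α ℤ.- (μ ℤ.+ μ) ≤ℤ x → x ≤ℤ α →
                  - α ℤ.- (μ ℤ.+ μ) ≤ℤ foldDown η x
foldDown-lower′ {η} {μ} {α} {x} 0≤η 0≤μ l u = ℤₚ.⊓-glb l
  (≤-by (ℤₚ.+-mono-≤ u (ℤₚ.+-mono-≤ (ℤₚ.+-mono-≤ 0≤η 0≤η) (ℤₚ.+-mono-≤ 0≤μ 0≤μ))) (eq η μ α x))
  where
  eq : ∀ η μ α x → (α ℤ.+ ((η ℤ.+ η) ℤ.+ (μ ℤ.+ μ))) ℤ.- (x ℤ.+ ((0ℤ ℤ.+ 0ℤ) ℤ.+ (0ℤ ℤ.+ 0ℤ)))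
                 ≡ (- x ℤ.+ (η ℤ.+ η)) ℤ.- (- α ℤ.- (μ ℤ.+ μ))
  eq = ℤ-Solver.solve-∀

neg-lower : ∀ {μ α x} → 0ℤ ≤ℤ μ → x ≤ℤ α → - α ℤ.- (μ ℤ.+ μ) ≤ℤ - x
neg-lower {μ} {α} {x} 0≤μ u = ≤-by (ℤₚ.+-mono-≤ u (ℤₚ.+-mono-≤ 0≤μ 0≤μ)) (eq μ α x)
  where
  eq : ∀ μ α x → (α ℤ.+ (μ ℤ.+ μ)) ℤ.- (x ℤ.+ (0ℤ ℤ.+ 0ℤ)) ≡ - x ℤ.- (- α ℤ.- (μ ℤ.+ μ))
  eq = ℤ-Solver.solve-∀

x⊓-x≤0 : ∀ x → x ⊓ - x ≤ℤ 0ℤ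
x⊓-x≤0 x with ℤₚ.≤-total x 0ℤ
... | inj₁ x≤0 = ℤₚ.≤-trans (ℤₚ.i⊓j≤i _ _) x≤0
... | inj₂ 0≤x = ℤₚ.≤-trans (ℤₚ.i⊓j≤j x _) (ℤₚ.neg-mono-≤ 0≤x)

-- Dynamics of the half array

module _ (π m : ℕ) (μ : ℤ) (H : ℕ → ℤ) where

  private
    p n : ℕ
    p = 4 + π
    n = 2 + π

    data Phase (t : ℕ) : Set where
      min-phase : ∀ q → t ≡ q * p → Phase t
      max-phase : ∀ q → t ≡ 1 + q * p → Phase t
      dec-phase : ∀ r q → t ≡ 2 + r + q * p → 2 + r < p → Phase t

    phase : ∀ t → Phase t
    phase t with t % p in e | m≡m%n+[m/n]*n t p | m%n<n t p
    ... | 0           | eq | _  = min-phase (t / p) eq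
    ... | 1           | eq | _  = max-phase (t / p) eq
    ... | suc (suc r) | eq | r< = dec-phase r (t / p) eq r<

  -- X τ i stands for x_{i+1} after τ steps.  When τ + i = r + q p with r < p, the last
  -- step acted on x_{i+1} by mov_{i+1} (r = 0), by cyc or mov_i (r = 1), or by the dec
  -- with s = n i + r - 1 (r ≥ 2).  The second alternatives in last-step and
  -- dec-step are the steps that the bounds on j and s exclude from the network.
  record Steps (X : ℕ → ℕ → ℤ) : Set where
    field
      min-step  : ∀ {τ i} q → suc i < m → suc τ + i ≡ q * p →
                  X (suc τ) i ≡ X τ i ⊓ X τ (suc i)
      last-step : ∀ {τ i} q → suc i ≡ m → suc τ + i ≡ q * p →
                  (X (suc τ) i ≡ X τ i ⊓ - X τ i) ⊎ ((X (suc τ) i ≡ X τ i) × (H (n * m) ≡ 0ℤ))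
      cyc-step  : ∀ {τ} q → suc τ + 0 ≡ 1 + q * p → X (suc τ) 0 ≡ foldUp μ (X τ 0)
      max-step  : ∀ {τ i} q → suc i < m → suc τ + suc i ≡ 1 + q * p →
                  X (suc τ) (suc i) ≡ X τ i ⊔ X τ (suc i)
      dec-step  : ∀ {τ i} r q → i < m → suc τ + i ≡ 2 + r + q * p → 2 + r < p →
                  (X (suc τ) i ≡ foldDown (H (suc (n * i + r))) (X τ i))
                  ⊎ ((X (suc τ) i ≡ X τ i) × (0 < r) × (H (n * i + r) ≡ 0ℤ))

  -- In the application `μ = m` and `H s = m h_s`. Then `H-halves` says `h_s ≤ 2 h_{s+1} + 1`, and
  -- `H-last` holds because `n * m ≥ k - 2` and `h_{k-2} = 1`.
  module Dynamics
    (0≤μ : 0ℤ ≤ℤ μ)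
    (0≤H : ∀ s → 0ℤ ≤ℤ H s)
    (H-antitone : ∀ {s t} → s ≤ t → H t ≤ℤ H s)
    (H-halves : ∀ s → H s ≤ℤ (H (suc s) ℤ.+ H (suc s)) ℤ.+ μ)
    (H-last : H (n * m) ≤ℤ μ)
    {X : ℕ → ℕ → ℤ}
    (steps : Steps X)
    (X₀-lower : ∀ {i} → i < m → - H 0 ℤ.- (μ ℤ.+ μ) ≤ℤ X 0 i)
    (X₀-upper : ∀ {i} → i < m → X 0 i ≤ℤ H 0)
    where

    open Steps steps

    private
      q≤qp : ∀ q → q ≤ q * p
      q≤qp q = ℕₚ.m≤m*n q p

      -- The inductions on time below bound the period index `q` from below by the column. This
      -- excludes time 0, where the column index would have to be `2 + r + q * p`.
      no-start : ∀ {i} r q → i ≤ suc q → ¬ (i ≡ 2 + r + q * p)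
      no-start r q i≤ refl = ℕₚ.<-irrefl refl
        (ℕₚ.≤-trans (s≤s (s≤s (ℕₚ.≤-trans (q≤qp q) (ℕₚ.m≤n+m (q * p) r)))) i≤)

      no-start₁ : ∀ {i} r q → i ≤ q → ¬ (i ≡ 1 + r + q * p)
      no-start₁ r q i≤ refl = ℕₚ.<-irrefl refl
        (ℕₚ.≤-trans (s≤s (ℕₚ.≤-trans (q≤qp q) (ℕₚ.m≤n+m (q * p) r))) i≤)

      no-start₀ : ∀ {i} q → i < q → ¬ (i ≡ q * p)
      no-start₀ q i< refl = ℕₚ.<-irrefl refl (ℕₚ.≤-trans (s≤s (q≤qp q)) i<)

      no-start₀′ : ∀ {i} q → i ≤ suc q → ¬ (i ≡ suc q * p)
      no-start₀′ q i≤ refl = ℕₚ.<-irrefl refl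
        (ℕₚ.≤-trans (s≤s (s≤s (ℕₚ.≤-trans (q≤qp q) (ℕₚ.m≤n+m (q * p) (2 + π))))) i≤)

      right : ∀ {τ i x} → suc τ + i ≡ x → τ + suc i ≡ x
      right {τ} {i} e = trans (ℕₚ.+-suc τ i) e

      left : ∀ {τ i x} → τ + suc i ≡ x → suc τ + i ≡ x
      left {τ} {i} e = trans (sym (ℕₚ.+-suc τ i)) e

      p∸1<p : suc (suc (suc π)) < p
      p∸1<p = ℕₚ.≤-refl

      stage-end : ∀ i → suc (n * i + suc π) ≡ n * suc i
      stage-end i = trans (sym (ℕₚ.+-suc (n * i) (suc π)))
                          (trans (ℕₚ.+-comm (n * i) n) (sym (ℕₚ.*-suc n i)))

    -- Bounds on the columns

    exchange-≤ : ∀ {τ i} q → i < m → suc τ + i ≡ q * p → X (suc τ) i ≤ℤ X τ i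
    exchange-≤ {τ} {i} q i<m e with ℕₚ.m≤n⇒m<n∨m≡n i<m
    ... | inj₁ i+1<m = subst (_≤ℤ X τ i) (sym (min-step q i+1<m e)) (ℤₚ.i⊓j≤i _ _)
    ... | inj₂ i+1≡m with last-step q i+1≡m e
    ...   | inj₁ eq       = subst (_≤ℤ X τ i) (sym eq) (ℤₚ.i⊓j≤i _ _)
    ...   | inj₂ (eq , _) = ℤₚ.≤-reflexive eq

    dec-≤ : ∀ {τ i} r q → i < m → suc τ + i ≡ 2 + r + q * p → 2 + r < p → X (suc τ) i ≤ℤ X τ i
    dec-≤ {τ} {i} r q i<m e r<p with dec-step r q i<m e r<p
    ... | inj₁ eq       = subst (_≤ℤ X τ i) (sym eq) (ℤₚ.i⊓j≤i _ _)
    ... | inj₂ (eq , _) = ℤₚ.≤-reflexive eq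

    -- Joint induction: cyc needs the lower bound to stay below `H 0`, while the decs and the
    -- negation in the last column need the upper bound to stay above `- H 0 - 2μ`.
    lower : ∀ τ {i} → i < m → - H 0 ℤ.- (μ ℤ.+ μ) ≤ℤ X τ i
    upper : ∀ τ {i} → i < m → X τ i ≤ℤ H 0

    lower zero i<m = X₀-lower i<m
    lower (suc τ) {i} i<m with phase (suc τ + i)
    ... | dec-phase r q e r<p with dec-step r q i<m e r<p
    ...   | inj₁ eq       = subst (_ ≤ℤ_) (sym eq) (foldDown-lower′ (0≤H _) 0≤μ (lower τ i<m) (upper τ i<m))
    ...   | inj₂ (eq , _) = subst (_ ≤ℤ_) (sym eq) (lower τ i<m)
    lower (suc τ) {zero} i<m | max-phase q e =
      subst (_ ≤ℤ_) (sym (cyc-step q e)) (ℤₚ.≤-trans (lower τ i<m) (ℤₚ.i≤i⊔j _ _))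
    lower (suc τ) {suc i} i<m | max-phase q e =
      subst (_ ≤ℤ_) (sym (max-step q i<m e)) (ℤₚ.≤-trans (lower τ i<m) (ℤₚ.i≤j⊔i (X τ i) _))
    lower (suc τ) {i} i<m | min-phase q e with ℕₚ.m≤n⇒m<n∨m≡n i<m
    ... | inj₁ i+1<m = subst (_ ≤ℤ_) (sym (min-step q i+1<m e)) (ℤₚ.⊓-glb (lower τ i<m) (lower τ i+1<m))
    ... | inj₂ i+1≡m with last-step q i+1≡m e
    ...   | inj₁ eq       = subst (_ ≤ℤ_) (sym eq) (ℤₚ.⊓-glb (lower τ i<m) (neg-lower 0≤μ (upper τ i<m)))
    ...   | inj₂ (eq , _) = subst (_ ≤ℤ_) (sym eq) (lower τ i<m)

    upper zero i<m = X₀-upper i<m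
    upper (suc τ) {i} i<m with phase (suc τ + i)
    ... | min-phase q e       = ℤₚ.≤-trans (exchange-≤ q i<m e) (upper τ i<m)
    ... | dec-phase r q e r<p = ℤₚ.≤-trans (dec-≤ r q i<m e r<p) (upper τ i<m)
    upper (suc τ) {zero} i<m | max-phase q e =
      subst (_≤ℤ H 0) (sym (cyc-step q e)) (foldUp-upper μ (lower τ i<m) (upper τ i<m))
    upper (suc τ) {suc i} i<m | max-phase q e =
      subst (_≤ℤ H 0) (sym (max-step q i<m e)) (ℤₚ.⊔-lub (upper τ (ℕₚ.<-trans ℕₚ.≤-refl i<m)) (upper τ i<m))

    -- The subscript r of upper₀, upper₁, upper₂ (and of the later families) is the number
    -- of steps completed in the period; 2 stands for 2 + r.  The lower bounds on q exclude
    -- what precedes the first reflections.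
    upper₀ : ∀ τ {i} q → i < m → 0 < q → i ≤ q → τ + i ≡ q * p → X τ i ≤ℤ H (n * suc i)
    upper₁ : ∀ τ {i} q → i < m → i ≤ q → τ + i ≡ 1 + q * p → X τ i ≤ℤ H (n * i + 0)
    upper₂ : ∀ τ {i} r q → i < m → i ≤ suc q → τ + i ≡ 2 + r + q * p → 2 + r < p → X τ i ≤ℤ H (suc (n * i + r))

    upper₀ zero (suc q) i<m _ i≤q e = ⊥-elim (no-start₀′ q i≤q e)
    upper₀ (suc τ) {i} (suc q) i<m _ i≤q e = ℤₚ.≤-trans (exchange-≤ (suc q) i<m e)
      (subst (λ s → X τ i ≤ℤ H s) (stage-end i) (upper₂ τ (suc π) q i<m i≤q (ℕₚ.suc-injective e) p∸1<p))

    upper₁ zero q i<m i≤q e = ⊥-elim (no-start₁ 0 q i≤q e)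
    upper₁ (suc τ) {zero} q i<m i≤q e = subst (λ s → X (suc τ) 0 ≤ℤ H s)
      (sym (trans (ℕₚ.+-identityʳ (n * 0)) (ℕₚ.*-zeroʳ n))) (upper (suc τ) i<m)
    upper₁ (suc τ) {suc i} (suc q) i<m i≤q e = subst₂ _≤ℤ_ (sym (max-step (suc q) i<m e))
      (cong H (sym (ℕₚ.+-identityʳ (n * suc i))))
      -- The incoming value has passed all decs of column `i`; the value already present has passed
      -- those of column `i + 1`, which gives an even smaller bound.
      (ℤₚ.⊔-lub
        (subst (λ s → X τ i ≤ℤ H s) (stage-end i)
          (upper₂ τ (suc π) q (ℕₚ.<-trans ℕₚ.≤-refl i<m) (ℕₚ.m≤n⇒m≤1+n (ℕ.s≤s⁻¹ i≤q))
             (ℕₚ.suc-injective (left (ℕₚ.suc-injective e))) p∸1<p))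
        (ℤₚ.≤-trans (upper₀ τ (suc q) i<m (s≤s z≤n) i≤q (ℕₚ.suc-injective e))
          (H-antitone (ℕₚ.*-monoʳ-≤ n (ℕₚ.n≤1+n (suc i))))))

    upper₂ zero r q i<m i≤q e r<p = ⊥-elim (no-start r q i≤q e)
    upper₂ (suc τ) r q i<m i≤q e r<p with dec-step r q i<m e r<p
    ... | inj₁ eq = subst (_≤ℤ H _) (sym eq) (foldDown-upper _ _)
    -- A dec is missing only where `H` already vanishes at the preceding index, so the bound from
    -- the preceding step says that the value is at most 0.
    upper₂ (suc τ) {i} (suc r) q i<m i≤q e r<p | inj₂ (eq , _ , H≡0) =
      subst (_≤ℤ H _) (sym eq) (ℤₚ.≤-trans
        (subst (λ s → X τ i ≤ℤ H s) (sym (ℕₚ.+-suc (n * i) r))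
          (upper₂ τ r q i<m i≤q (ℕₚ.suc-injective e) (ℕₚ.<-trans ℕₚ.≤-refl r<p)))
        (subst (_≤ℤ H (suc (n * i + suc r))) (sym H≡0) (0≤H _)))

    -- A value emitted by cyc is at least `- μ`, and it enters each later column as an argument of a
    -- maximum. Inside a column, the dec with bound `H s` meets a value at most
    -- `H (s - 1) ≤ 2 H s + μ`, so its reflection stays above `- μ`. Each move to the right raises
    -- the period index by one, whence `i ≤ q`.
    reflected₁ : ∀ τ {i} q → i < m → i ≤ q → τ + i ≡ 1 + q * p → - μ ≤ℤ X τ i
    reflected₂ : ∀ τ {i} r q → i < m → i ≤ q → τ + i ≡ 2 + r + q * p → 2 + r < p → - μ ≤ℤ X τ i

    reflected₁ zero q i<m i≤q e = ⊥-elim (no-start₁ 0 q i≤q e)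
    reflected₁ (suc τ) {zero} q i<m i≤q e = subst (- μ ≤ℤ_) (sym (cyc-step q e)) (foldUp-lower μ _)
    reflected₁ (suc τ) {suc i} (suc q) i<m i≤q e = subst (- μ ≤ℤ_) (sym (max-step (suc q) i<m e))
      (ℤₚ.≤-trans
        (reflected₂ τ (suc π) q (ℕₚ.<⇒≤ i<m) (ℕ.s≤s⁻¹ i≤q) (ℕₚ.suc-injective (left (ℕₚ.suc-injective e))) p∸1<p)
        (ℤₚ.i≤i⊔j _ _))

    reflected₂ zero r q i<m i≤q e r<p = ⊥-elim (no-start r q (ℕₚ.m≤n⇒m≤1+n i≤q) e)
    reflected₂ (suc τ) {i} r q i<m i≤q e r<p with dec-step r q i<m e r<p | before r e r<p
      where
      before : ∀ r → suc τ + i ≡ 2 + r + q * p → 2 + r < p → (- μ ≤ℤ X τ i) × (X τ i ≤ℤ H (n * i + r))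
      before zero e _ = reflected₁ τ q i<m i≤q (ℕₚ.suc-injective e) , upper₁ τ q i<m i≤q (ℕₚ.suc-injective e)
      before (suc r) e r<p =
        reflected₂ τ r q i<m i≤q (ℕₚ.suc-injective e) (ℕₚ.<⇒≤ r<p) ,
        subst (λ s → X τ i ≤ℤ H s) (sym (ℕₚ.+-suc (n * i) r))
          (upper₂ τ r q i<m (ℕₚ.m≤n⇒m≤1+n i≤q) (ℕₚ.suc-injective e) (ℕₚ.<⇒≤ r<p))
    ... | inj₁ eq       | l , u = subst (- μ ≤ℤ_) (sym eq) (foldDown-lower (H (suc (n * i + r))) l (ℤₚ.≤-trans u (H-halves _)))
    ... | inj₂ (eq , _) | l , _ = subst (- μ ≤ℤ_) (sym eq) l

    -- By induction towards the last column: the minimum left behind by an exchange comes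
    -- from the minimum that the next column was left with one step earlier.
    exchanged : ∀ τ {i} q → i < m → m ≤ q → τ + i ≡ q * p → (- μ ≤ℤ X τ i) × (X τ i ≤ℤ 0ℤ)
    exchanged zero q i<m m≤q e = ⊥-elim (no-start₀ q (ℕₚ.<-≤-trans i<m m≤q) e)
    exchanged (suc τ) {i} zero i<m m≤q ()
    exchanged (suc τ) {i} (suc q) i<m m≤q e with ℕₚ.m≤n⇒m<n∨m≡n i<m
       | reflected₂ τ (suc π) q i<m (ℕ.s≤s⁻¹ (ℕₚ.<-≤-trans i<m m≤q)) (ℕₚ.suc-injective e) p∸1<p
    ... | inj₁ i+1<m | l = subst (λ x → (- μ ≤ℤ x) × (x ≤ℤ 0ℤ)) (sym (min-step (suc q) i+1<m e))
                             (ℤₚ.⊓-glb l (proj₁ next) , ℤₚ.≤-trans (ℤₚ.i⊓j≤j (X τ i) _) (proj₂ next))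
      where next = exchanged τ (suc q) i+1<m m≤q (right e)
    ... | inj₂ i+1≡m | l with last-step (suc q) i+1≡m e
       | subst (λ s → X τ i ≤ℤ H s) (trans (stage-end i) (cong (n *_) i+1≡m))
           (upper₂ τ (suc π) q i<m (ℕₚ.≤-trans (ℕₚ.<⇒≤ i<m) m≤q) (ℕₚ.suc-injective e) p∸1<p)
    -- Here `x ≤ H (n * m) ≤ μ`, so `- x` is at least `- μ` as well.
    ...   | inj₁ eq | u = subst (λ x → (- μ ≤ℤ x) × (x ≤ℤ 0ℤ)) (sym eq)
                            (ℤₚ.⊓-glb l (ℤₚ.neg-mono-≤ (ℤₚ.≤-trans u H-last)) , x⊓-x≤0 (X τ i))
    -- Without `mov_m` nothing reflects the value, but the last bound `H (n * m)` is then 0.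
    ...   | inj₂ (eq , H≡0) | u = subst (λ x → (- μ ≤ℤ x) × (x ≤ℤ 0ℤ)) (sym eq) (l , subst (_ ≤ℤ_) H≡0 u)

    -- From period `m` on, `exchanged` makes cyc idle, so column 0 emits values at most 0. Such a
    -- value needs one further period per column, whence `m + i ≤ q`; the values it is joined with
    -- by the maxima are at most 0 by `exchanged`.
    settled₁ : ∀ τ {i} q → i < m → m + i ≤ q → τ + i ≡ 1 + q * p → X τ i ≤ℤ 0ℤ
    settled₂ : ∀ τ {i} r q → i < m → m + i ≤ q → τ + i ≡ 2 + r + q * p → 2 + r < p → X τ i ≤ℤ 0ℤ

    settled₁ zero q i<m m+i≤q e = ⊥-elim (no-start₁ 0 q (ℕₚ.m+n≤o⇒n≤o m m+i≤q) e)
    settled₁ (suc τ) {zero} q i<m m+i≤q e =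
      subst (_≤ℤ 0ℤ) (sym (trans (cyc-step q e) (foldUp-id μ (proj₁ was)))) (proj₂ was)
      where was = exchanged τ q i<m (ℕₚ.m+n≤o⇒m≤o m m+i≤q) (ℕₚ.suc-injective e)
    settled₁ (suc τ) {suc i} zero i<m m+i≤q e with ℕₚ.m+n≤o⇒n≤o m m+i≤q
    ... | ()
    settled₁ (suc τ) {suc i} (suc q) i<m m+i≤q e = subst (_≤ℤ 0ℤ) (sym (max-step (suc q) i<m e))
      (ℤₚ.⊔-lub
        (settled₂ τ (suc π) q (ℕₚ.<⇒≤ i<m) (ℕ.s≤s⁻¹ (subst (_≤ suc q) (ℕₚ.+-suc m i) m+i≤q))
          (ℕₚ.suc-injective (left (ℕₚ.suc-injective e))) p∸1<p)
        (proj₂ (exchanged τ (suc q) i<m (ℕₚ.m+n≤o⇒m≤o m m+i≤q) (ℕₚ.suc-injective e))))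

    settled₂ zero r q i<m m+i≤q e r<p = ⊥-elim (no-start r q (ℕₚ.m≤n⇒m≤1+n (ℕₚ.m+n≤o⇒n≤o m m+i≤q)) e)
    settled₂ (suc τ) zero q i<m m+i≤q e r<p =
      ℤₚ.≤-trans (dec-≤ zero q i<m e r<p) (settled₁ τ q i<m m+i≤q (ℕₚ.suc-injective e))
    settled₂ (suc τ) (suc r) q i<m m+i≤q e r<p =
      ℤₚ.≤-trans (dec-≤ (suc r) q i<m e r<p) (settled₂ τ r q i<m m+i≤q (ℕₚ.suc-injective e) (ℕₚ.<⇒≤ r<p))

    -- Sorting once the reflections are idle

    dec-id : ∀ τ {i} r q → i < m → m + i ≤ q → suc τ + i ≡ 2 + r + q * p → 2 + r < p → X (suc τ) i ≡ X τ i
    dec-id τ {i} r q i<m m+i≤q e r<p with dec-step r q i<m e r<p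
    ... | inj₂ (eq , _) = eq
    ... | inj₁ eq = trans eq (foldDown-id (0≤H _) (before r e r<p))
      where
      before : ∀ r → suc τ + i ≡ 2 + r + q * p → 2 + r < p → X τ i ≤ℤ 0ℤ
      before zero e _ = settled₁ τ q i<m m+i≤q (ℕₚ.suc-injective e)
      before (suc r) e r<p = settled₂ τ r q i<m m+i≤q (ℕₚ.suc-injective e) (ℕₚ.<⇒≤ r<p)

    -- One and the same exchange has just put the minimum into column `i` and the maximum into
    -- column `i + 1`.
    sorted₀ : ∀ τ {i} q → suc i < m → m ≤ q → τ + i ≡ q * p → X τ i ≤ℤ X τ (suc i)
    sorted₀ zero q i<m m≤q e = ⊥-elim (no-start₀ q (ℕₚ.<-≤-trans (ℕₚ.<⇒≤ i<m) m≤q) e)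
    sorted₀ (suc τ) {i} q i<m m≤q e =
      subst₂ _≤ℤ_ (sym (min-step q i<m e)) (sym (max-step q i<m (cong suc (right e))))
        (ℤₚ.≤-trans (ℤₚ.i⊓j≤i (X τ i) _) (ℤₚ.i≤i⊔j _ _))

    -- The bound `2 + r < p` means that column `i + 1` has not yet reached its next exchange. As the
    -- decs are idle, only `r = 0` matters. In column 0 cyc is idle too; any other column has just
    -- received a maximum, whose two arguments are compared with the next column by `skip` and
    -- `sorted₀`.
    sorted₁ : ∀ τ {i} r q → suc i < m → m + suc i ≤ q → τ + i ≡ 1 + r + q * p → 2 + r < p →
              X τ i ≤ℤ X τ (suc i)
    -- Just after column i + 1 has been exchanged, it holds the smaller of two values, so the
    -- value carried in column i is compared with column i + 2 instead.
    skip : ∀ τ {i} q → suc (suc i) < m → m + suc i ≤ q → τ + i ≡ 3 + π + q * p → X τ i ≤ℤ X τ (suc (suc i))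

    sorted₁ zero r q i<m m+i<q e r<p =
      ⊥-elim (no-start₁ r q (ℕₚ.<⇒≤ (ℕₚ.m+n≤o⇒n≤o m m+i<q)) e)
    sorted₁ (suc τ) {i} (suc r) q i<m m+i<q e r<p = subst₂ _≤ℤ_
      (sym (dec-id τ r q (ℕₚ.<⇒≤ i<m) (ℕₚ.≤-trans (ℕₚ.+-monoʳ-≤ m (ℕₚ.n≤1+n i)) m+i<q) e (ℕₚ.<⇒≤ r<p)))
      (sym (dec-id τ (suc r) q i<m m+i<q (cong suc (right e)) r<p))
      (sorted₁ τ r q i<m m+i<q (ℕₚ.suc-injective e) (ℕₚ.<⇒≤ r<p))
    sorted₁ (suc τ) {zero} zero q i<m m+i<q e r<p = subst₂ _≤ℤ_
      (sym (trans (cyc-step q e) (foldUp-id μ (proj₁ (exchanged τ q (ℕₚ.<⇒≤ i<m) m≤q e′)))))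
      (sym (dec-id τ zero q i<m m+i<q (cong suc (right e)) r<p))
      (sorted₀ τ q i<m m≤q e′)
      where
      m≤q = ℕₚ.m+n≤o⇒m≤o m m+i<q
      e′  = ℕₚ.suc-injective e
    sorted₁ (suc τ) {suc i} zero zero i<m m+i<q e r<p with ℕₚ.m+n≤o⇒n≤o m m+i<q
    ... | ()
    sorted₁ (suc τ) {suc i} zero (suc q) i<m m+i<q e r<p = subst₂ _≤ℤ_
      (sym (max-step (suc q) (ℕₚ.<⇒≤ i<m) e))
      (sym (dec-id τ zero (suc q) i<m m+i<q (cong suc (right e)) r<p))
      (ℤₚ.⊔-lub
        (skip τ q i<m (ℕ.s≤s⁻¹ (subst (_≤ suc q) (ℕₚ.+-suc m (suc i)) m+i<q)) (ℕₚ.suc-injective (left (ℕₚ.suc-injective e))))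
        (sorted₀ τ (suc q) i<m (ℕₚ.m+n≤o⇒m≤o m m+i<q) (ℕₚ.suc-injective e)))

    skip zero q i<m m+i<q e = ⊥-elim (no-start (suc π) q
      (ℕₚ.≤-trans (ℕₚ.n≤1+n _) (ℕₚ.m≤n⇒m≤1+n (ℕₚ.m+n≤o⇒n≤o m m+i<q))) e)
    skip (suc τ) {i} q i<m m+i<q e = subst₂ _≤ℤ_
      (sym (dec-id τ (suc π) q (ℕₚ.<⇒≤ (ℕₚ.<⇒≤ i<m)) (ℕₚ.≤-trans (ℕₚ.+-monoʳ-≤ m (ℕₚ.n≤1+n i)) m+i<q) e p∸1<p))
      (sym (max-step (suc q) i<m (trans (ℕₚ.+-suc (suc τ) (suc i)) (cong suc (trans (ℕₚ.+-suc (suc τ) i) (cong suc e))))))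
      (ℤₚ.≤-trans (sorted₁ τ (suc π) q (ℕₚ.<⇒≤ i<m) m+i<q (ℕₚ.suc-injective e) p∸1<p) (ℤₚ.i≤i⊔j _ _))

    -- Column `i + 1` has just kept the smaller of two values. Induction towards the last column
    -- shows that these were already in order; in the last column the value is at most 0, so it does
    -- not exceed its negative.
    sorted₂ : ∀ τ {i} q → suc i < m → m + m ≤ suc q → τ + i ≡ 3 + π + q * p → X τ i ≤ℤ X τ (suc i)
    sorted₂ zero {i} q i<m 2m≤q e =
      ⊥-elim (no-start (suc π) q (ℕₚ.≤-trans (ℕₚ.<⇒≤ (ℕₚ.<⇒≤ i<m)) (ℕₚ.m+n≤o⇒m≤o m 2m≤q)) e)
    sorted₂ (suc τ) {i} q i<m 2m≤q e = subst (_≤ℤ X (suc τ) (suc i))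
      (sym (dec-id τ (suc π) q (ℕₚ.<⇒≤ i<m) (ℕₚ.≤-trans (ℕₚ.+-monoʳ-≤ m (ℕₚ.n≤1+n i)) m+i<q) e p∸1<p)) below
      where
      m+i<q : m + suc i ≤ q
      m+i<q = ℕ.s≤s⁻¹ (ℕₚ.≤-trans (subst (_≤ m + m) (ℕₚ.+-suc m (suc i)) (ℕₚ.+-monoʳ-≤ m i<m)) 2m≤q)

      here : X τ i ≤ℤ X τ (suc i)
      here = sorted₁ τ (suc π) q i<m m+i<q (ℕₚ.suc-injective e) p∸1<p

      e′ : suc τ + suc i ≡ suc q * p
      e′ = cong suc (right e)

      below : X τ i ≤ℤ X (suc τ) (suc i)
      below with ℕₚ.m≤n⇒m<n∨m≡n i<m
      ... | inj₁ i+2<m = subst (X τ i ≤ℤ_) (sym (min-step (suc q) i+2<m e′))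
              (ℤₚ.⊓-glb here (ℤₚ.≤-trans here (sorted₂ τ q i+2<m 2m≤q (right e))))
      ... | inj₂ i+2≡m with last-step (suc q) i+2≡m e′
      ...   | inj₂ (eq , _) = subst (X τ i ≤ℤ_) (sym eq) here
      ...   | inj₁ eq = subst (X τ i ≤ℤ_) (sym eq)
                (ℤₚ.⊓-glb here (ℤₚ.≤-trans here (ℤₚ.≤-trans x≤0 (ℤₚ.neg-mono-≤ x≤0))))
        where
        x≤0 : X τ (suc i) ≤ℤ 0ℤ
        x≤0 = settled₂ τ (suc π) q i<m m+i<q (right e) p∸1<p

    -- The state at the final time

    module _ {τ Q : ℕ} (τ≡Qp : τ ≡ Q * p) (1+Q≡2m : suc Q ≡ m + m) where

      private
        -- From `Q * p ≤ τ + i < (q + 1) * p` follows `Q < q + 1`.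
        late : ∀ {i} r q → τ + i ≡ r + q * p → r < p → m + m ≤ suc q
        late {i} r q e r<p = subst (_≤ suc q) 1+Q≡2m (ℕₚ.*-cancelʳ-< p Q (suc q)
          (ℕₚ.≤-<-trans (subst (_≤ τ + i) τ≡Qp (ℕₚ.m≤m+n τ i))
            (subst (_< p + q * p) (sym e) (ℕₚ.+-monoˡ-< (q * p) r<p))))

        late-+ : ∀ {i} r q → i < m → τ + i ≡ r + q * p → r < p → m + i ≤ q
        late-+ {i} r q i<m e r<p =
          ℕ.s≤s⁻¹ (ℕₚ.≤-trans (ℕₚ.+-monoʳ-< m i<m) (late r q e r<p))

      final-bounds : ∀ {i} → i < m → (- μ ≤ℤ X τ i) × (X τ i ≤ℤ 0ℤ)
      final-bounds {i} i<m with phase (τ + i)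
      ... | min-phase q e = exchanged τ q i<m (ℕₚ.m+n≤o⇒m≤o m (late-+ 0 q i<m e (s≤s z≤n))) e
      ... | max-phase q e = reflected₁ τ q i<m (ℕₚ.m+n≤o⇒n≤o m m+i≤q) e , settled₁ τ q i<m m+i≤q e
        where m+i≤q = late-+ 1 q i<m e (s≤s (s≤s z≤n))
      ... | dec-phase r q e r<p = reflected₂ τ r q i<m (ℕₚ.m+n≤o⇒n≤o m m+i≤q) e r<p , settled₂ τ r q i<m m+i≤q e r<p
        where m+i≤q = late-+ (2 + r) q i<m e r<p

      final-sorted : ∀ {i} → suc i < m → X τ i ≤ℤ X τ (suc i)
      final-sorted {i} i+1<m with phase (τ + i)
      ... | min-phase q e = sorted₀ τ q i+1<m
              (ℕₚ.m+n≤o⇒m≤o m (late-+ 0 q (ℕₚ.<⇒≤ i+1<m) e (s≤s z≤n))) e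
      ... | max-phase q e = sorted₁ τ 0 q i+1<m
              (late-+ 2 q i+1<m (trans (ℕₚ.+-suc τ i) (cong suc e)) (s≤s (s≤s (s≤s z≤n)))) e (s≤s (s≤s (s≤s z≤n)))
      ... | dec-phase r q e r<p with ℕₚ.m≤n⇒m<n∨m≡n r<p
      ...   | inj₁ r+1<p = sorted₁ τ (suc r) q i+1<m
                (late-+ (3 + r) q i+1<m (trans (ℕₚ.+-suc τ i) (cong suc e)) r+1<p) e r+1<p
      -- Column `i` is in phase `p - 1`, so column `i + 1` has just been exchanged with its right
      -- neighbour.
      ...   | inj₂ refl = sorted₂ τ q i+1<m (late (2 + r) q e r<p) e

-- Folding the maps of the network

≡ᵇ-refl : ∀ n → (n ≡ᵇ n) ≡ true
≡ᵇ-refl zero    = refl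
≡ᵇ-refl (suc n) = ≡ᵇ-refl n

≢⇒≡ᵇ-false : ∀ {m n} → m ≢ n → (m ≡ᵇ n) ≡ false
≢⇒≡ᵇ-false {m} {n} m≢n with m ≡ᵇ n | ℕₚ.≡ᵇ⇒≡ m n
... | false | _ = refl
... | true  | f = ⊥-elim (m≢n (f tt))

update : ℕ → ℤ → Seq → Seq
update j v X t = if t ≡ᵇ j then v else X t

update-same : ∀ j v X → update j v X j ≡ v
update-same j v X rewrite ≡ᵇ-refl j = refl

update-other : ∀ j v X {t} → t ≢ j → update j v X t ≡ X t
update-other j v X t≢j rewrite ≢⇒≡ᵇ-false t≢j = refl

cyc-last : ∀ {b} c → b ≢ 1 → cyc b c b ≡ (c 1 ℤ.+ 1ℤ) ⊓ c b
cyc-last {b} c b≢1 rewrite ≢⇒≡ᵇ-false b≢1 | ≡ᵇ-refl b = refl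

cyc-other : ∀ {b t} c → t ≢ 1 → t ≢ b → cyc b c t ≡ c t
cyc-other c t≢1 t≢b rewrite ≢⇒≡ᵇ-false t≢1 | ≢⇒≡ᵇ-false t≢b = refl

module _ (b j : ℕ) {j′ : ℕ} (mirror : b + 1 ∸ j ≡ j′) where

  dec-left : ∀ hs c → dec b j hs c j ≡ c j ⊓ (c j′ ℤ.+ + hs)
  dec-left hs c rewrite ≡ᵇ-refl j | mirror = refl

  dec-right : ∀ hs c → j′ ≢ j → dec b j hs c j′ ≡ (c j ℤ.- + hs) ⊔ c j′
  dec-right hs c j′≢j rewrite mirror | ≢⇒≡ᵇ-false j′≢j | ≡ᵇ-refl j′ = refl

  dec-other : ∀ {t} hs c → t ≢ j → t ≢ j′ → dec b j hs c t ≡ c t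
  dec-other hs c t≢j t≢j′ rewrite mirror | ≢⇒≡ᵇ-false t≢j | ≢⇒≡ᵇ-false t≢j′ = refl

  mov-min : ∀ {t} c → (t ≡ j) ⊎ (t ≡ b ∸ j) → mov b j c t ≡ c t ⊓ c (suc t)
  mov-min c (inj₁ refl) rewrite ≡ᵇ-refl j = refl
  mov-min c (inj₂ refl) with (b ∸ j) ≡ᵇ j
  ... | true  = refl
  ... | false rewrite ≡ᵇ-refl (b ∸ j) = refl

  mov-max : ∀ {t} c → t ≢ j → t ≢ b ∸ j → (t ≡ suc j) ⊎ (t ≡ j′) → mov b j c t ≡ c (t ∸ 1) ⊔ c t
  mov-max {t} c t≢j t≢b∸j eq rewrite ≢⇒≡ᵇ-false t≢j | ≢⇒≡ᵇ-false t≢b∸j | mirror with eq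
  ... | inj₁ refl rewrite ≡ᵇ-refl j = refl
  ... | inj₂ refl with j′ ≡ᵇ suc j
  ...   | true  = refl
  ...   | false rewrite ≡ᵇ-refl j′ = refl

  mov-other : ∀ {t} c → t ≢ j → t ≢ b ∸ j → t ≢ suc j → t ≢ j′ → mov b j c t ≡ c t
  mov-other c t≢j t≢b∸j t≢1+j t≢j′
    rewrite ≢⇒≡ᵇ-false t≢j | ≢⇒≡ᵇ-false t≢b∸j | mirror | ≢⇒≡ᵇ-false t≢1+j | ≢⇒≡ᵇ-false t≢j′ = refl

-- Right neighbour in the half array; across the middle it is `x_{m+1} = - x_m`.
next : ℕ → Seq → ℕ → ℤ
next m X i = if suc i ≡ᵇ m then - X i else X (suc i)

next-inner : ∀ {m i} X → suc i < m → next m X i ≡ X (suc i)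
next-inner X i+1<m rewrite ≢⇒≡ᵇ-false (ℕₚ.<⇒≢ i+1<m) = refl

next-last : ∀ {m i} X → suc i ≡ m → next m X i ≡ - X i
next-last {i = i} X refl rewrite ≡ᵇ-refl i = refl

halfCyc : ℕ → Seq → Seq
halfCyc m X = update 0 (foldUp (+ m) (X 0)) X

halfDec : ℤ → ℕ → Seq → Seq
halfDec η i X = update i (foldDown η (X i)) X

-- If `i + 1 = m`, the inner update writes to index `m`, outside the half array; the maximum of `x`
-- and `- x` is already represented as the negative of the new column `i`.
halfMov : ℕ → ℕ → Seq → Seq
halfMov m i X = update i (X i ⊓ next m X i) (update (suc i) (X i ⊔ next m X i) X)

module _ (m i : ℕ) (X : Seq) where

  private
    Y : Seq
    Y = update (suc i) (X i ⊔ next m X i) X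

  halfMov-here : halfMov m i X i ≡ X i ⊓ next m X i
  halfMov-here = update-same i _ Y

  halfMov-next : halfMov m i X (suc i) ≡ X i ⊔ next m X i
  halfMov-next = trans (update-other i _ Y ℕₚ.1+n≢n) (update-same (suc i) _ X)

  halfMov-other : ∀ {t} → t ≢ i → t ≢ suc i → halfMov m i X t ≡ X t
  halfMov-other t≢i t≢1+i = trans (update-other i _ Y t≢i) (update-other (suc i) _ X t≢1+i)

module Folding
  (m : ℕ) (φ : ℤ → ℤ)
  (φ-mono : ∀ {x y} → x ≤ℤ y → φ x ≤ℤ φ y)
  (φ-shift : ∀ x d → φ (x ℤ.+ (+ (m * d) ℤ.+ + (m * d))) ≡ φ x ℤ.+ + d)
  where

  b : ℕ
  b = 2 * m

  Folded : Seq → Seq → Set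
  Folded c X = ∀ {i} → i < m → (c (suc i) ≡ φ (X i)) × (c (b ∸ i) ≡ φ (- X i))

  φ-⊓ : ∀ x y → φ (x ⊓ y) ≡ φ x ⊓ φ y
  φ-⊓ = ℤₚ.mono-≤-distrib-⊓ φ-mono

  φ-⊔ : ∀ x y → φ (x ⊔ y) ≡ φ x ⊔ φ y
  φ-⊔ = ℤₚ.mono-≤-distrib-⊔ φ-mono

  φ-unshift : ∀ x d → φ (x ℤ.- (+ (m * d) ℤ.+ + (m * d))) ≡ φ x ℤ.- + d
  φ-unshift x d = trans (eq₁ _ (+ d))
    (cong (ℤ._- + d) (trans (sym (φ-shift _ d)) (cong φ (eq₂ x (+ (m * d))))))
    where
    eq₁ : ∀ u d → u ≡ (u ℤ.+ d) ℤ.- d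
    eq₁ = ℤ-Solver.solve-∀
    eq₂ : ∀ x η → (x ℤ.- (η ℤ.+ η)) ℤ.+ (η ℤ.+ η) ≡ x
    eq₂ = ℤ-Solver.solve-∀

  φ-neg-⊓ : ∀ x y → φ (- (x ⊓ y)) ≡ φ (- x) ⊔ φ (- y)
  φ-neg-⊓ x y = trans (cong φ (ℤₚ.neg-distrib-⊓-⊔ x y)) (φ-⊔ _ _)

  φ-neg-⊔ : ∀ x y → φ (- (x ⊔ y)) ≡ φ (- x) ⊓ φ (- y)
  φ-neg-⊔ x y = trans (cong φ (ℤₚ.neg-distrib-⊔-⊓ x y)) (φ-⊓ _ _)

  foldDown-folds : ∀ x d → φ (foldDown (+ (m * d)) x) ≡ φ x ⊓ (φ (- x) ℤ.+ + d)
  foldDown-folds x d = trans (φ-⊓ _ _) (cong (φ x ⊓_) (φ-shift (- x) d))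

  foldDown-folds⁻ : ∀ x d → φ (- foldDown (+ (m * d)) x) ≡ (φ x ℤ.- + d) ⊔ φ (- x)
  foldDown-folds⁻ x d = trans (φ-neg-⊓ _ _) (trans (ℤₚ.⊔-comm (φ (- x)) _)
    (cong (_⊔ φ (- x)) (trans (cong φ (eq x (+ (m * d)))) (φ-unshift x d))))
    where
    eq : ∀ x η → - (- x ℤ.+ (η ℤ.+ η)) ≡ x ℤ.- (η ℤ.+ η)
    eq = ℤ-Solver.solve-∀

  -- Reflection about `- m` involves a shift by `2m`, which `φ` turns into the constant 1 of cyc.
  foldUp-folds : ∀ x → φ (foldUp (+ m) x) ≡ φ x ⊔ (φ (- x) ℤ.- 1ℤ)
  foldUp-folds x = trans (φ-⊔ _ _) (cong (φ x ⊔_)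
    (trans (cong (λ k → φ (- x ℤ.- (+ k ℤ.+ + k))) (sym (ℕₚ.*-identityʳ m))) (φ-unshift (- x) 1)))

  foldUp-folds⁻ : ∀ x → φ (- foldUp (+ m) x) ≡ (φ x ℤ.+ 1ℤ) ⊓ φ (- x)
  foldUp-folds⁻ x = trans (φ-neg-⊔ _ _) (trans (ℤₚ.⊓-comm (φ (- x)) _)
    (cong (_⊓ φ (- x)) (trans (cong φ (eq x (+ m)))
      (trans (cong (λ k → φ (x ℤ.+ (+ k ℤ.+ + k))) (sym (ℕₚ.*-identityʳ m))) (φ-shift x 1)))))
    where
    eq : ∀ x μ → - (- x ℤ.- (μ ℤ.+ μ)) ≡ x ℤ.+ (μ ℤ.+ μ)
    eq = ℤ-Solver.solve-∀

  mirror : ∀ i → b + 1 ∸ suc i ≡ b ∸ i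
  mirror i = cong (_∸ suc i) (ℕₚ.+-comm b 1)

  b≡m+m : b ≡ m + m
  b≡m+m = cong (_+_ m) (ℕₚ.+-identityʳ m)

  m<mirror : ∀ {i} → i < m → m < b ∸ i
  m<mirror {i} i<m = ℕₚ.m+n≤o⇒m≤o∸n (suc m) (subst (suc m + i ≤_) (sym b≡m+m) (ℕₚ.+-monoʳ-< m i<m))

  i≤b : ∀ {i} → i < m → i ≤ b
  i≤b i<m = ℕₚ.≤-trans (ℕₚ.<⇒≤ i<m) (ℕₚ.m≤m+n m _)

  left≢right : ∀ {i i′} → i < m → i′ < m → suc i ≢ b ∸ i′
  left≢right i<m i′<m eq = ℕₚ.<⇒≢ (ℕₚ.≤-<-trans i<m (m<mirror i′<m)) eq

  left≢left : ∀ {i i′} → i ≢ i′ → suc i ≢ suc i′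
  left≢left i≢i′ eq = i≢i′ (ℕₚ.suc-injective eq)

  right≢right : ∀ {i i′} → i < m → i′ < m → i ≢ i′ → b ∸ i ≢ b ∸ i′
  right≢right i<m i′<m i≢i′ eq = i≢i′ (ℕₚ.∸-cancelˡ-≡ (i≤b i<m) (i≤b i′<m) eq)

  folded-cyc : 0 < m → ∀ {c X} → Folded c X → Folded (cyc b c) (halfCyc m X)
  folded-cyc 0<m {c} {X} F {zero} i<m =
    trans (cong₂ (λ u v → u ⊔ (v ℤ.- 1ℤ)) (proj₁ (F 0<m)) (proj₂ (F 0<m))) (sym (foldUp-folds (X 0))) ,
    trans (cyc-last c (λ eq → left≢right 0<m 0<m (sym eq)))
      (trans (cong₂ (λ u v → (u ℤ.+ 1ℤ) ⊓ v) (proj₁ (F 0<m)) (proj₂ (F 0<m))) (sym (foldUp-folds⁻ (X 0))))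
  folded-cyc 0<m {c} F {suc i} i<m =
    trans (cyc-other c (λ ()) (left≢right i<m 0<m)) (proj₁ (F i<m)) ,
    trans (cyc-other c (λ eq → left≢right 0<m i<m (sym eq)) (right≢right i<m 0<m (λ ()))) (proj₂ (F i<m))

  folded-dec : ∀ {j} → j < m → ∀ d {c X} → Folded c X → Folded (dec b (suc j) d c) (halfDec (+ (m * d)) j X)
  folded-dec {j} j<m d {c} {X} F {i} i<m with i ℕₚ.≟ j
  ... | yes refl =
    trans (dec-left b (suc i) (mirror i) d c) (trans (cong₂ (λ u v → u ⊓ (v ℤ.+ + d)) (proj₁ (F i<m)) (proj₂ (F i<m)))
      (trans (sym (foldDown-folds (X i) d)) (cong φ (sym (update-same i _ X))))) ,
    trans (dec-right b (suc i) (mirror i) d c (λ eq → left≢right i<m i<m (sym eq)))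
      (trans (cong₂ (λ u v → (u ℤ.- + d) ⊔ v) (proj₁ (F i<m)) (proj₂ (F i<m)))
        (trans (sym (foldDown-folds⁻ (X i) d)) (cong (λ x → φ (- x)) (sym (update-same i _ X)))))
  ... | no i≢j =
    trans (dec-other b (suc j) (mirror j) d c (left≢left i≢j) (left≢right i<m j<m))
      (trans (proj₁ (F i<m)) (cong φ (sym (update-other j _ X i≢j)))) ,
    trans (dec-other b (suc j) (mirror j) d c (λ eq → left≢right j<m i<m (sym eq)) (right≢right i<m j<m i≢j))
      (trans (proj₂ (F i<m)) (cong (λ x → φ (- x)) (sym (update-other j _ X i≢j))))

  suc-mirror : ∀ {i} → i < m → suc (b ∸ suc i) ≡ b ∸ i
  suc-mirror i<m = sym (ℕₚ.+-∸-assoc 1 (ℕₚ.≤-trans i<m (ℕₚ.m≤m+n m _)))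

  mirror-pred : ∀ {i} → i < m → b ∸ i ∸ 1 ≡ b ∸ suc i
  mirror-pred i<m = cong (_∸ 1) (sym (suc-mirror i<m))

  -- For `j = m` the two coordinates that `mov_j` lowers coincide, and so do the two that it raises;
  -- hence the separate treatment of the last column.
  middle : ∀ {i} → suc i ≡ m → b ∸ suc i ≡ suc i
  middle refl = trans (cong (_∸ m) b≡m+m) (ℕₚ.m+n∸m≡n m m)

  folded-mov-inner : ∀ {j} → suc j < m → ∀ {c X} → Folded c X → Folded (mov b (suc j) c) (halfMov m j X)
  folded-mov-inner {j} j+1<m {c} {X} F {i} i<m with i ℕₚ.≟ j | i ℕₚ.≟ suc j
  ... | yes refl | _ =
    trans (mov-min b (suc j) (mirror j) c (inj₁ refl))
      (trans (cong₂ _⊓_ (proj₁ (F i<m)) (proj₁ (F j+1<m)))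
        (trans (sym (φ-⊓ _ _)) (cong φ (sym here)))) ,
    trans (mov-max b (suc j) (mirror j) c (λ eq → left≢right i<m i<m (sym eq)) (right≢right i<m j+1<m (λ ())) (inj₂ refl))
      (trans (cong₂ _⊔_ (trans (cong c (mirror-pred i<m)) (proj₂ (F j+1<m))) (proj₂ (F i<m)))
        (trans (ℤₚ.⊔-comm (φ (- X (suc j))) _) (trans (sym (φ-neg-⊓ _ _)) (cong (λ x → φ (- x)) (sym here)))))
    where here = trans (halfMov-here m j X) (cong (X j ⊓_) (next-inner X j+1<m))
  ... | no _ | yes refl =
    trans (mov-max b (suc j) (mirror j) c (λ ()) (left≢right i<m i<m) (inj₁ refl))
      (trans (cong₂ _⊔_ (proj₁ (F (ℕₚ.<⇒≤ i<m))) (proj₁ (F i<m)))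
        (trans (sym (φ-⊔ _ _)) (cong φ (sym there)))) ,
    trans (mov-min b (suc j) (mirror j) c (inj₂ refl))
      (trans (cong₂ _⊓_ (proj₂ (F i<m)) (trans (cong c (suc-mirror (ℕₚ.<⇒≤ i<m))) (proj₂ (F (ℕₚ.<⇒≤ i<m)))))
        (trans (ℤₚ.⊓-comm (φ (- X (suc j))) _) (trans (sym (φ-neg-⊔ _ _)) (cong (λ x → φ (- x)) (sym there)))))
    where there = trans (halfMov-next m j X) (cong (X j ⊔_) (next-inner X j+1<m))
  ... | no i≢j | no i≢1+j =
    trans (mov-other b (suc j) (mirror j) c (left≢left i≢j) (left≢right i<m j+1<m) (left≢left i≢1+j) (left≢right i<m j<m))
      (trans (proj₁ (F i<m)) (cong φ (sym (halfMov-other m j X i≢j i≢1+j)))) ,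
    trans (mov-other b (suc j) (mirror j) c (λ eq → left≢right j<m i<m (sym eq)) (right≢right i<m j+1<m i≢1+j)
             (λ eq → left≢right j+1<m i<m (sym eq)) (right≢right i<m j<m i≢j))
      (trans (proj₂ (F i<m)) (cong (λ x → φ (- x)) (sym (halfMov-other m j X i≢j i≢1+j))))
    where j<m = ℕₚ.<⇒≤ j+1<m

  folded-mov-last : ∀ {j} → suc j ≡ m → ∀ {c X} → Folded c X → Folded (mov b (suc j) c) (halfMov m j X)
  folded-mov-last {j} j+1≡m {c} {X} F {i} i<m with i ℕₚ.≟ j
  ... | yes refl =
    trans (mov-min b (suc j) (mirror j) c (inj₁ refl))
      (trans (cong₂ _⊓_ (proj₁ (F i<m)) (trans (cong c across) (proj₂ (F i<m))))
        (trans (sym (φ-⊓ _ _)) (cong φ (sym here)))) ,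
    trans (mov-max b (suc j) (mirror j) c right≢j (λ eq → right≢j (trans eq (middle j+1≡m))) (inj₂ refl))
      (trans (cong₂ _⊔_ (trans (cong c (trans (mirror-pred i<m) (middle j+1≡m))) (proj₁ (F i<m))) (proj₂ (F i<m)))
        -- Writing `x` as `- - x` exhibits the maximum as `φ` of the negative of `x ⊓ - x`.
        (trans (cong (λ x → φ x ⊔ φ (- X j)) (sym (ℤₚ.neg-involutive (X j))))
          (trans (ℤₚ.⊔-comm (φ (- - X j)) _) (trans (sym (φ-neg-⊓ _ _)) (cong (λ x → φ (- x)) (sym here))))))
    where
    here = trans (halfMov-here m j X) (cong (X j ⊓_) (next-last X j+1≡m))
    across = trans (cong suc (sym (middle j+1≡m))) (suc-mirror i<m)
    right≢j : b ∸ j ≢ suc j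
    right≢j eq = left≢right i<m i<m (sym eq)
  ... | no i≢j =
    trans (mov-other b (suc j) (mirror j) c (left≢left i≢j) (λ eq → left≢left i≢j (trans eq (middle j+1≡m)))
             (λ eq → left≢right i<m j<m (trans eq across)) (left≢right i<m j<m))
      (trans (proj₁ (F i<m)) (cong φ (sym same))) ,
    trans (mov-other b (suc j) (mirror j) c (λ eq → left≢right j<m i<m (sym eq))
             (λ eq → left≢right j<m i<m (sym (trans eq (middle j+1≡m))))
             (λ eq → right≢right i<m j<m i≢j (trans eq across)) (right≢right i<m j<m i≢j))
      (trans (proj₂ (F i<m)) (cong (λ x → φ (- x)) (sym same)))
    where
    j<m = ℕₚ.≤-reflexive j+1≡m
    across = trans (cong suc (sym (middle j+1≡m))) (suc-mirror j<m)
    same = halfMov-other m j X i≢j (ℕₚ.<⇒≢ (subst (i <_) (sym j+1≡m) i<m))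

  folded-mov : ∀ {j} → j < m → ∀ {c X} → Folded c X → Folded (mov b (suc j) c) (halfMov m j X)
  folded-mov j<m {c} {X} F with ℕₚ.m≤n⇒m<n∨m≡n j<m
  ... | inj₁ j+1<m = folded-mov-inner j+1<m {c} {X} F
  ... | inj₂ j+1≡m = folded-mov-last j+1≡m {c} {X} F

  -- The left half is sorted by assumption, the right half by negation; the halves join because
  -- `x_m ≤ 0 ≤ - x_m`, and the wrap-around is `- x_1 ≤ x_1 + 2m`.
  flat : 0 < m → ∀ {c X} → Folded c X → (∀ {i} → i < m → (- (+ m) ≤ℤ X i) × (X i ≤ℤ 0ℤ)) →
         (∀ {i} → suc i < m → X i ≤ℤ X (suc i)) → Flat b c
  flat 0<m {c} {X} F bounds sorted = rises , wraps
    where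
    rises : ∀ t → 1 ≤ t → t < b → c t ≤ℤ c (suc t)
    rises (suc i) _ t<b with ℕₚ.<-cmp (suc i) m
    ... | tri< i+1<m _ _ = subst₂ _≤ℤ_ (sym (proj₁ (F (ℕₚ.<⇒≤ i+1<m)))) (sym (proj₁ (F i+1<m))) (φ-mono (sorted i+1<m))
    ... | tri≈ _ i+1≡m _ = subst₂ _≤ℤ_ (sym (proj₁ (F i<m)))
            (sym (trans (cong c (trans (cong suc (sym (middle i+1≡m))) (suc-mirror i<m))) (proj₂ (F i<m))))
            (φ-mono (ℤₚ.≤-trans x≤0 (ℤₚ.neg-mono-≤ x≤0)))
      where
      i<m = ℕₚ.≤-reflexive i+1≡m
      x≤0 = proj₂ (bounds i<m)
    ... | tri> _ _ m<i+1 = subst₂ _≤ℤ_ (sym (trans (cong c (sym t≡)) (proj₂ (F u+1<m))))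
            (sym (trans (cong c (trans (cong suc (sym t≡)) (suc-mirror u<m))) (proj₂ (F u<m))))
            (φ-mono (ℤₚ.neg-mono-≤ (sorted u+1<m)))
      where
      -- Coordinate `suc i` mirrors column `suc u`, and its successor mirrors column `u`.
      u : ℕ
      u = b ∸ suc (suc i)

      u+1≡ : suc u ≡ b ∸ suc i
      u+1≡ = sym (ℕₚ.+-∸-assoc 1 t<b)

      u+1<m : suc u < m
      u+1<m = subst₂ _<_ (sym u+1≡) (trans (cong (_∸ m) b≡m+m) (ℕₚ.m+n∸m≡n m m))
                (ℕₚ.∸-monoʳ-< m<i+1 (ℕₚ.<⇒≤ t<b))

      u<m = ℕₚ.<⇒≤ u+1<m

      t≡ : b ∸ suc u ≡ suc i
      t≡ = trans (cong (b ∸_) u+1≡) (ℕₚ.m∸[m∸n]≡n (ℕₚ.<⇒≤ t<b))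

    wraps : c b ≤ℤ c 1 ℤ.+ 1ℤ
    wraps = subst₂ _≤ℤ_ (sym (proj₂ (F 0<m)))
      (trans (φ-shift (X 0) 1) (cong (ℤ._+ 1ℤ) (sym (proj₁ (F 0<m)))))
      (φ-mono (≤-by (ℤₚ.+-mono-≤ l l) (trans (eq (X 0) (+ m)) (cong (λ k → (X 0 ℤ.+ (+ k ℤ.+ + k)) ℤ.- (- X 0))
        (sym (ℕₚ.*-identityʳ m))))))
      where
      l = proj₁ (bounds 0<m)
      eq : ∀ x μ → (x ℤ.+ x) ℤ.- (- μ ℤ.+ - μ) ≡ (x ℤ.+ (μ ℤ.+ μ)) ℤ.- (- x)
      eq = ℤ-Solver.solve-∀

-- The schedule

≤⇒≤ᵇ-true : ∀ {m n} → m ≤ n → (m ≤ᵇ n) ≡ true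
≤⇒≤ᵇ-true {m} {n} m≤n with m ≤ᵇ n | ℕₚ.≤⇒≤ᵇ m≤n
... | true | _ = refl

>⇒≤ᵇ-false : ∀ {m n} → n < m → (m ≤ᵇ n) ≡ false
>⇒≤ᵇ-false {m} {n} n<m with m ≤ᵇ n | ℕₚ.≤ᵇ⇒≤ m n
... | false | _ = refl
... | true  | f = ⊥-elim (ℕₚ.<⇒≱ n<m (f tt))

module _ (k s : ℕ) where

  private
    suc-exponent : k ∸ suc s ∸ 1 ≡ k ∸ s ∸ 1 ∸ 1
    suc-exponent = cong (_∸ 1) (trans (cong (k ∸_) (ℕₚ.+-comm 1 s)) (sym (ℕₚ.∸-+-assoc k s 1)))

  -- This is the equality `h_s = 2 h_{s+1} + 1` while the exponent of `h_s` is positive; once the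
  -- truncated exponent is 0, `h_s` is 0.
  h-halves : h k s ≤ h k (suc s) + h k (suc s) + 1
  h-halves rewrite suc-exponent with k ∸ s ∸ 1
  ... | zero  = z≤n
  ... | suc e with 2 ^ e | ℕₚ.m^n>0 2 e
  ...   | suc x | _ = ℕₚ.≤-reflexive (trans (cong (λ y → x + y) (ℕₚ.+-identityʳ (suc x)))
                        (trans (ℕₚ.+-suc x x) (ℕₚ.+-comm 1 (x + x))))

  h-vanishes : k ∸ 1 ≤ s → h k s ≡ 0
  h-vanishes k∸1≤s = cong (λ e → 2 ^ e ∸ 1) (trans (ℕₚ.∸-+-assoc k s 1)
    (trans (cong (k ∸_) (ℕₚ.+-comm s 1)) (trans (sym (ℕₚ.∸-+-assoc k 1 s)) (ℕₚ.m≤n⇒m∸n≡0 k∸1≤s))))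

  h-antitone : ∀ {t} → s ≤ t → h k t ≤ h k s
  h-antitone s≤t = ℕₚ.∸-monoˡ-≤ 1 (ℕₚ.^-monoʳ-≤ 2 (ℕₚ.∸-monoˡ-≤ 1 (ℕₚ.∸-monoʳ-≤ k s≤t)))

module _ (N n′ : ℕ) where

  private n = suc n′

  i<ceilDiv⇒i*n<N : ∀ {i} → i < ceilDiv N n → i * n < N
  i<ceilDiv⇒i*n<N {i} i<m = ℕₚ.+-cancelʳ-≤ n′ (suc (i * n)) N
    (ℕₚ.≤-trans (ℕₚ.≤-reflexive (cong suc (ℕₚ.+-comm (i * n) n′)))
      (ℕₚ.≤-trans (ℕₚ.*-monoˡ-≤ n i<m) (m/n*n≤m (N + n′) n)))

  N≤ceilDiv*n : N ≤ ceilDiv N n * n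
  N≤ceilDiv*n = ℕₚ.+-cancelʳ-≤ n′ N _ (ℕₚ.≤-trans
    (ℕₚ.≤-reflexive (m≡m%n+[m/n]*n (N + n′) n))
    (ℕₚ.≤-trans (ℕₚ.+-monoˡ-≤ _ (ℕ.s≤s⁻¹ (m%n<n (N + n′) n))) (ℕₚ.≤-reflexive (ℕₚ.+-comm n′ _))))

module Reduction (π k : ℕ) (p≤k : 4 + π ≤ k) where

  p n m : ℕ
  p = 4 + π
  n = 2 + π
  m = ceilDiv (k ∸ 2) n

  b/2≡m : bOf p k / 2 ≡ m
  b/2≡m = trans (cong (_/ 2) (ℕₚ.*-comm 2 m)) (m*n/n≡m m 2)

  0<m : 0 < m
  0<m with m | N≤ceilDiv*n (k ∸ 2) (1 + π)
  ... | suc _ | _ = s≤s z≤n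
  ... | zero  | k-2≤0 with ℕₚ.≤-trans (ℕₚ.∸-monoˡ-≤ 2 p≤k) k-2≤0
  ...   | ()

  H : ℕ → ℤ
  H s = + (m * h k s)

  H-antitone : ∀ {s t} → s ≤ t → H t ≤ℤ H s
  H-antitone {s} s≤t = +≤+ (ℕₚ.*-monoʳ-≤ m (h-antitone k s s≤t))

  H-halves : ∀ s → H s ≤ℤ (H (suc s) ℤ.+ H (suc s)) ℤ.+ + m
  H-halves s = +≤+ (ℕₚ.≤-trans (ℕₚ.*-monoʳ-≤ m (h-halves k s)) (ℕₚ.≤-reflexive
    (trans (ℕₚ.*-distribˡ-+ m _ 1) (cong₂ _+_ (ℕₚ.*-distribˡ-+ m _ _) (ℕₚ.*-identityʳ m)))))

  H-vanishes : ∀ {s} → k ∸ 1 ≤ s → H s ≡ 0ℤ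
  H-vanishes {s} k∸1≤s = cong +_ (trans (cong (m *_) (h-vanishes k s k∸1≤s)) (ℕₚ.*-zeroʳ m))

  H-last : H (n * m) ≤ℤ + m
  H-last = ℤₚ.≤-trans (H-antitone (subst (k ∸ 2 ≤_) (ℕₚ.*-comm m n) (N≤ceilDiv*n (k ∸ 2) (1 + π))))
    (+≤+ (ℕₚ.≤-reflexive (trans (cong (λ e → m * (2 ^ (e ∸ 1) ∸ 1)) (ℕₚ.m∸[m∸n]≡n 2≤k)) (ℕₚ.*-identityʳ m))))
    where 2≤k = ℕₚ.≤-trans (s≤s (s≤s z≤n)) p≤k

  -- The network acting on the half array

  halfStep : ℕ → ℕ → Seq → Seq
  halfStep x i X =
    (if inDC p k x (suc i) then halfDec (H (sOf p x (suc i))) i else id)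
    ((if inMV p k x (suc i) then halfMov m i else id) X)

  halfSteps : ℕ → ℕ → Seq → Seq
  halfSteps x zero    X = X
  halfSteps x (suc i) X = halfStep x i (halfSteps x i X)

  cycled : ℕ → Seq → Seq
  cycled x X = if x ≡ᵇ 1 then halfCyc m X else X

  half : Seq → ℕ → Seq
  half X zero    = X
  half X (suc τ) = halfSteps (τ % p + 1) m (cycled (τ % p + 1) (half X τ))

  -- Step `τ + 1` applies `Q_x` with `x = τ % p + 1`, so the phase of a column can be read off from
  -- `x`.
  residue : ∀ τ i → (τ % p + 1 + i) % p ≡ (suc τ + i) % p
  residue τ i = trans (cong (_% p) (ℕₚ.+-assoc (τ % p) 1 i))
    (trans (%-distribˡ-+ (τ % p) (suc i) p)
    (trans (cong (λ r → (r + suc i % p) % p) (m%n%n≡m%n τ p))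
    (trans (sym (%-distribˡ-+ τ (suc i) p)) (cong (_% p) (ℕₚ.+-suc τ i)))))

  residue-sOf : ∀ τ i r q → suc τ + i ≡ r + q * p → r < p → (τ % p + 1 + suc i ∸ 1) mod p ≡ r
  residue-sOf τ i r q e r<p = trans (cong (λ t → (t ∸ 1) % p) (ℕₚ.+-suc (τ % p + 1) i))
    (trans (residue τ i) (trans (cong (_% p) e) (trans ([m+kn]%n≡m%n r q p) (m<n⇒m%n≡m r<p))))

  residue-suc : ∀ τ i r q → suc τ + i ≡ r + q * p → (τ % p + 1 + suc i) mod p ≡ suc r % p
  residue-suc τ i r q e = trans (residue τ (suc i))
    (trans (cong (_% p) (trans (ℕₚ.+-suc (suc τ) i) (cong suc e))) ([m+kn]%n≡m%n (suc r) q p))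

  -- In a dec phase `x + j` is congruent to `3 + r`. This residue is at least 3 or wraps round to 0,
  -- so it avoids the residues 1 and 2 excluded from `DC_x`.
  suc-r%p : ∀ r → 2 + r < p → ((3 + r) % p ≡ 3 + r) ⊎ ((3 + r) % p ≡ 0)
  suc-r%p r r<p with ℕₚ.m≤n⇒m<n∨m≡n r<p
  ... | inj₁ r+1<p = inj₁ (m<n⇒m%n≡m r+1<p)
  ... | inj₂ refl  = inj₂ (n%n≡0 p)

  module _ (τ i q : ℕ) where

    private x = τ % p + 1

    inMV-on : suc τ + i ≡ q * p → suc i * n ≤ k ∸ 2 → inMV p k x (suc i) ≡ true
    inMV-on e i≤ rewrite residue-suc τ i 0 q e | ≤⇒≤ᵇ-true i≤ = refl

    inMV-large : k ∸ 2 < suc i * n → inMV p k x (suc i) ≡ false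
    inMV-large i> rewrite >⇒≤ᵇ-false i> = refl

    inMV-off : ∀ r → suc τ + i ≡ suc r + q * p → suc r < p → inMV p k x (suc i) ≡ false
    inMV-off zero    e r<p rewrite residue-suc τ i 1 q e = Boolₚ.∧-zeroʳ _
    inMV-off (suc r) e r<p with suc-r%p r r<p
    ... | inj₁ eq rewrite residue-suc τ i (2 + r) q e | eq = Boolₚ.∧-zeroʳ _
    ... | inj₂ eq rewrite residue-suc τ i (2 + r) q e | eq = Boolₚ.∧-zeroʳ _

    inDC-off₀ : suc τ + i ≡ q * p → inDC p k x (suc i) ≡ false
    inDC-off₀ e rewrite residue-suc τ i 0 q e = Boolₚ.∧-zeroʳ _

    inDC-off₁ : suc τ + i ≡ 1 + q * p → inDC p k x (suc i) ≡ false
    inDC-off₁ e rewrite residue-suc τ i 1 q e = Boolₚ.∧-zeroʳ _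

    module _ (r : ℕ) (e : suc τ + i ≡ 2 + r + q * p) (r<p : 2 + r < p) where

      sOf-dec : sOf p x (suc i) ≡ suc (n * i + r)
      sOf-dec = trans (cong (λ t → n * i + t ∸ 1) (residue-sOf τ i (2 + r) q e r<p))
        (cong (_∸ 1) (trans (ℕₚ.+-suc (n * i) (suc r)) (cong suc (ℕₚ.+-suc (n * i) r))))

      inDC-dec : i < m → inDC p k x (suc i) ≡ (suc (n * i + r) ≤ᵇ k ∸ 1)
      inDC-dec i<m with suc-r%p r r<p
      ... | inj₁ eq
        rewrite sOf-dec | residue-suc τ i (2 + r) q e | eq
              | ≤⇒≤ᵇ-true {suc i} {bOf p k / 2} (subst (suc i ≤_) (sym b/2≡m) i<m) = refl
      ... | inj₂ eq
        rewrite sOf-dec | residue-suc τ i (2 + r) q e | eq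
              | ≤⇒≤ᵇ-true {suc i} {bOf p k / 2} (subst (suc i ≤_) (sym b/2≡m) i<m) = refl

  module _ (x : ℕ) where

    halfStep-away : ∀ {i t} X → t ≢ i → t ≢ suc i → halfStep x i X t ≡ X t
    halfStep-away {i} {t} X t≢i t≢1+i with inDC p k x (suc i) | inMV p k x (suc i)
    ... | false | false = refl
    ... | false | true  = halfMov-other m i X t≢i t≢1+i
    ... | true  | false = update-other i _ X t≢i
    ... | true  | true  = trans (update-other i _ (halfMov m i X) t≢i) (halfMov-other m i X t≢i t≢1+i)

    halfStep-unmoved : ∀ {i t} X → inMV p k x (suc i) ≡ false → t ≢ i → halfStep x i X t ≡ X t
    halfStep-unmoved {i} X off t≢i rewrite off with inDC p k x (suc i)
    ... | false = refl
    ... | true  = update-other i _ X t≢i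

    halfStep-id : ∀ {i} X → inMV p k x (suc i) ≡ false → inDC p k x (suc i) ≡ false → halfStep x i X ≡ X
    halfStep-id X mv-off dc-off rewrite mv-off | dc-off = refl

    halfStep-mov : ∀ {i} X → inMV p k x (suc i) ≡ true → inDC p k x (suc i) ≡ false → halfStep x i X ≡ halfMov m i X
    halfStep-mov X mv-on dc-off rewrite mv-on | dc-off = refl

    halfStep-dec : ∀ {i} X → inMV p k x (suc i) ≡ false → inDC p k x (suc i) ≡ true →
                   halfStep x i X ≡ halfDec (H (sOf p x (suc i))) i X
    halfStep-dec X mv-off dc-on rewrite mv-off | dc-on = refl

    halfSteps-beyond : ∀ l {t} X → l < t → halfSteps x l X t ≡ X t
    halfSteps-beyond zero    X l<t = refl
    halfSteps-beyond (suc l) X l<t = trans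
      (halfStep-away (halfSteps x l X) (λ eq → ℕₚ.<⇒≢ (ℕₚ.<⇒≤ l<t) (sym eq)) (λ eq → ℕₚ.<⇒≢ l<t (sym eq)))
      (halfSteps-beyond l X (ℕₚ.<⇒≤ l<t))

    -- The steps after the one at index `t` touch only columns beyond `t`.
    halfSteps-after : ∀ l {t} X → t < l → halfSteps x l X t ≡ halfSteps x (suc t) X t
    halfSteps-after (suc l) {t} X t<l with ℕₚ.m≤n⇒m<n∨m≡n (ℕ.s≤s⁻¹ t<l)
    ... | inj₂ refl = refl
    ... | inj₁ t<l′ = trans
      (halfStep-away (halfSteps x l X) (ℕₚ.<⇒≢ t<l′) (ℕₚ.<⇒≢ t<l)) (halfSteps-after l X t<l′)

  module _ (X₀ : Seq) (τ : ℕ) where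

    private
      x : ℕ
      x = τ % p + 1

      X Z : Seq
      X = half X₀ τ
      Z = cycled x X

      p∸1<p : 3 + π < p
      p∸1<p = ℕₚ.≤-refl

    cycled-suc : ∀ i → Z (suc i) ≡ X (suc i)
    cycled-suc i with x ≡ᵇ 1
    ... | true  = refl
    ... | false = refl

    no-cyc : ∀ r q → suc τ + 0 ≡ r + q * p → r < p → r ≢ 1 → x ≢ 1
    no-cyc r q e r<p r≢1 eq = r≢1 (trans (sym (trans (residue τ 0) (trans (cong (_% p) e)
      (trans ([m+kn]%n≡m%n r q p) (m<n⇒m%n≡m r<p))))) (cong (λ y → (y + 0) % p) eq))

    cycled-id : ∀ {i} r q → suc τ + i ≡ r + q * p → r < p → r ≢ 1 → Z i ≡ X i
    cycled-id {suc i} r q e r<p r≢1 = cycled-suc i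
    cycled-id {zero} r q e r<p r≢1 rewrite ≢⇒≡ᵇ-false (no-cyc r q e r<p r≢1) = refl

    cycled-cyc : ∀ q → suc τ + 0 ≡ 1 + q * p → Z 0 ≡ foldUp (+ m) (X 0)
    cycled-cyc q e rewrite trans (cong (λ t → t % p) (trans (sym (ℕₚ.+-identityʳ τ)) (ℕₚ.suc-injective e))) (m*n%n≡0 q p) = refl

    -- Before its own step, column `i` can only be changed by `mov_i`, or by cyc if `i = 0`, and
    -- either acts only in phase 1.
    before : ∀ {i} r q → suc τ + i ≡ r + q * p → r < p → r ≢ 1 → halfSteps x i Z i ≡ X i
    before {zero} r q e r<p r≢1 = cycled-id r q e r<p r≢1
    before {suc i} 0 (suc q) e r<p r≢1 = trans
      (halfStep-unmoved x (halfSteps x i Z) (inMV-off τ i q (2 + π) (ℕₚ.suc-injective (trans (sym (ℕₚ.+-suc (suc τ) i)) e)) p∸1<p) ℕₚ.1+n≢n)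
      (trans (halfSteps-beyond x i Z ℕₚ.≤-refl) (cycled-suc i))
    before {suc i} 1 q e r<p r≢1 = ⊥-elim (r≢1 refl)
    before {suc i} (suc (suc r)) q e r<p r≢1 = trans
      (halfStep-unmoved x (halfSteps x i Z) (inMV-off τ i q r (ℕₚ.suc-injective (trans (sym (ℕₚ.+-suc (suc τ) i)) e)) (ℕₚ.<⇒≤ r<p)) ℕₚ.1+n≢n)
      (trans (halfSteps-beyond x i Z ℕₚ.≤-refl) (cycled-suc i))

    mov-next : ∀ {i} q → suc i < m → suc τ + i ≡ q * p → next m (halfSteps x i Z) i ≡ X (suc i)
    mov-next {i} q i+1<m e = trans (next-inner (halfSteps x i Z) i+1<m)
      (trans (halfSteps-beyond x i Z ℕₚ.≤-refl) (cycled-suc i))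

    mov-on : ∀ {i} q → suc i < m → suc τ + i ≡ q * p → inMV p k x (suc i) ≡ true
    mov-on {i} q i+1<m e = inMV-on τ i q e (ℕₚ.<⇒≤ (i<ceilDiv⇒i*n<N (k ∸ 2) (1 + π) i+1<m))

    half-at : ∀ {i} → i < m → half X₀ (suc τ) i ≡ halfStep x i (halfSteps x i Z) i
    half-at i<m = halfSteps-after x m Z i<m

    half-min : ∀ {i} q → suc i < m → suc τ + i ≡ q * p → half X₀ (suc τ) i ≡ X i ⊓ X (suc i)
    half-min {i} q i+1<m e = trans (half-at (ℕₚ.<⇒≤ i+1<m))
      (trans (cong (λ Y → Y i) (halfStep-mov x (halfSteps x i Z) (mov-on q i+1<m e) (inDC-off₀ τ i q e)))
      (trans (halfMov-here m i (halfSteps x i Z))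
        (cong₂ _⊓_ (before 0 q e (s≤s z≤n) (λ ())) (mov-next q i+1<m e))))

    -- The network contains `mov_m` only if `m * n ≤ k - 2`. Otherwise `n * m ≥ k - 1`, where `H`
    -- vanishes.
    half-last : ∀ {i} q → suc i ≡ m → suc τ + i ≡ q * p →
                (half X₀ (suc τ) i ≡ X i ⊓ - X i) ⊎ ((half X₀ (suc τ) i ≡ X i) × (H (n * m) ≡ 0ℤ))
    half-last {i} q i+1≡m e with suc i * n ℕₚ.≤? k ∸ 2
    ... | yes i+1≤ = inj₁ (trans (half-at (ℕₚ.≤-reflexive i+1≡m))
      (trans (cong (λ Y → Y i) (halfStep-mov x (halfSteps x i Z) (inMV-on τ i q e i+1≤) (inDC-off₀ τ i q e)))
      (trans (halfMov-here m i (halfSteps x i Z))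
        (cong₂ _⊓_ here (trans (next-last (halfSteps x i Z) i+1≡m) (cong -_ here))))))
      where here = before 0 q e (s≤s z≤n) (λ ())
    ... | no i+1≰ = inj₂ (trans (half-at (ℕₚ.≤-reflexive i+1≡m))
      (trans (cong (λ Y → Y i) (halfStep-id x (halfSteps x i Z) (inMV-large τ i q i+1>) (inDC-off₀ τ i q e)))
        (before 0 q e (s≤s z≤n) (λ ()))) ,
      H-vanishes (subst₂ _≤_ k∸2+1 (trans (cong (_* n) i+1≡m) (ℕₚ.*-comm m n)) i+1>))
      where
      i+1> = ℕₚ.≰⇒> i+1≰
      k∸2+1 : suc (k ∸ 2) ≡ k ∸ 1
      k∸2+1 = sym (ℕₚ.+-∸-assoc 1 (ℕₚ.≤-trans (s≤s (s≤s z≤n)) p≤k))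

    half-cyc : ∀ q → suc τ + 0 ≡ 1 + q * p → half X₀ (suc τ) 0 ≡ foldUp (+ m) (X 0)
    half-cyc q e = trans (half-at 0<m)
      (trans (cong (λ Y → Y 0) (halfStep-id x Z (inMV-off τ 0 q 0 e (s≤s (s≤s z≤n))) (inDC-off₁ τ 0 q e))) (cycled-cyc q e))

    half-max : ∀ {i} q → suc i < m → suc τ + suc i ≡ 1 + q * p → half X₀ (suc τ) (suc i) ≡ X i ⊔ X (suc i)
    half-max {i} q i+1<m e = trans (half-at i+1<m)
      (trans (cong (λ Y → Y (suc i)) (halfStep-id x (halfSteps x (suc i) Z) (inMV-off τ (suc i) q 0 e (s≤s (s≤s z≤n))) (inDC-off₁ τ (suc i) q e)))
      (trans (cong (λ Y → Y (suc i)) (halfStep-mov x (halfSteps x i Z) (mov-on q i+1<m e′) (inDC-off₀ τ i q e′)))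
      (trans (halfMov-next m i (halfSteps x i Z))
        (cong₂ _⊔_ (before 0 q e′ (s≤s z≤n) (λ ())) (mov-next q i+1<m e′)))))
      where
      e′ : suc τ + i ≡ q * p
      e′ = ℕₚ.suc-injective (trans (sym (ℕₚ.+-suc (suc τ) i)) e)

    -- The dec is left out when `s = n * i + r + 1` exceeds `k - 1`, and then `H (n * i + r) = 0`.
    -- The case `r = 0` cannot occur there, since `i < m` gives `n * i < k - 2`.
    half-dec : ∀ {i} r q → i < m → suc τ + i ≡ 2 + r + q * p → 2 + r < p →
               (half X₀ (suc τ) i ≡ foldDown (H (suc (n * i + r))) (X i))
               ⊎ ((half X₀ (suc τ) i ≡ X i) × (0 < r) × (H (n * i + r) ≡ 0ℤ))
    half-dec {i} r q i<m e r<p with suc (n * i + r) ℕₚ.≤? k ∸ 1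
    ... | yes s≤ = inj₁ (trans (half-at i<m)
      (trans (cong (λ Y → Y i) (halfStep-dec x (halfSteps x i Z) (inMV-off τ i q (suc r) e r<p)
                (trans (inDC-dec τ i q r e r<p i<m) (≤⇒≤ᵇ-true s≤))))
      (trans (update-same i _ (halfSteps x i Z))
        (cong₂ (λ s → foldDown (H s)) (sOf-dec τ i q r e r<p) (before (2 + r) q e r<p (λ ()))))))
    ... | no s≰ = inj₂ (trans (half-at i<m)
      (trans (cong (λ Y → Y i) (halfStep-id x (halfSteps x i Z) (inMV-off τ i q (suc r) e r<p)
                (trans (inDC-dec τ i q r e r<p i<m) (>⇒≤ᵇ-false (ℕₚ.≰⇒> s≰)))))
        (before (2 + r) q e r<p (λ ()))) ,
      0<r r k∸1≤ , H-vanishes k∸1≤)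
      where
      k∸1≤ = ℕ.s≤s⁻¹ (ℕₚ.≰⇒> s≰)

      0<r : ∀ r → k ∸ 1 ≤ n * i + r → 0 < r
      0<r (suc r) _ = s≤s z≤n
      0<r zero    k∸1≤ = ⊥-elim (ℕₚ.<⇒≱ (i<ceilDiv⇒i*n<N (k ∸ 2) (1 + π) i<m)
        (ℕₚ.≤-trans (ℕₚ.∸-monoʳ-≤ k (s≤s z≤n))
          (subst (k ∸ 1 ≤_) (trans (ℕₚ.+-identityʳ _) (ℕₚ.*-comm n i)) k∸1≤)))

  half-steps : ∀ X₀ → Steps π m (+ m) H (half X₀)
  half-steps X₀ = record
    { min-step  = half-min X₀ _
    ; last-step = half-last X₀ _
    ; cyc-step  = half-cyc X₀ _
    ; max-step  = half-max X₀ _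
    ; dec-step  = half-dec X₀ _
    }

  module _
    (φ : ℤ → ℤ)
    (φ-mono : ∀ {x y} → x ≤ℤ y → φ x ≤ℤ φ y)
    (φ-shift : ∀ x d → φ (x ℤ.+ (+ (m * d) ℤ.+ + (m * d))) ≡ φ x ℤ.+ + d)
    where

    open Folding m φ φ-mono φ-shift

    folded-step : ∀ x {i} → i < m → ∀ {c X} → Folded c X → Folded (stepJ p k x (suc i) c) (halfStep x i X)
    folded-step x {i} i<m {c} {X} F with inMV p k x (suc i) | inDC p k x (suc i)
    ... | false | false = F
    ... | false | true  = folded-dec i<m (h k (sOf p x (suc i))) {c} {X} F
    ... | true  | false = folded-mov i<m {c} {X} F
    ... | true  | true  = folded-dec i<m (h k (sOf p x (suc i))) {mov (bOf p k) (suc i) c} {halfMov m i X} (folded-mov i<m {c} {X} F)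

    folded-steps : ∀ x l → l ≤ m → ∀ {c X} → Folded c X → Folded (stepsUpTo p k x l c) (halfSteps x l X)
    folded-steps x zero    l≤m F = F
    folded-steps x (suc l) l≤m {c} {X} F =
      folded-step x l≤m {stepsUpTo p k x l c} {halfSteps x l X} (folded-steps x l (ℕₚ.<⇒≤ l≤m) {c} {X} F)

    folded-Q : ∀ x {c X} → Folded c X → Folded (Q p k x c) (halfSteps x m (cycled x X))
    folded-Q x {c} {X} F rewrite b/2≡m with x ≡ᵇ 1
    ... | true  = folded-steps x m ℕₚ.≤-refl {cyc (bOf p k) c} {halfCyc m X} (folded-cyc 0<m {c} {X} F)
    ... | false = folded-steps x m ℕₚ.≤-refl {c} {X} F

    folded-f : ∀ {c X} → Folded c X → ∀ τ → Folded (fUpTo p k τ c) (half X τ)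
    folded-f F zero    = F
    folded-f {c} {X} F (suc τ) = folded-Q (τ % p + 1) {fUpTo p k τ c} {half X τ} (folded-f {c} {X} F τ)

    flat-f : ∀ {c X} → Folded c X →
             (∀ {i} → i < m → - H 0 ℤ.- (+ m ℤ.+ + m) ≤ℤ X i) → (∀ {i} → i < m → X i ≤ℤ H 0) →
             Flat (bOf p k) (f p k c)
    flat-f {c} {X} F lower upper = flat 0<m {f p k c} {half X (DOf p k)} (folded-f {c} {X} F (DOf p k))
      (D.final-bounds D≡Qp 1+Q≡2m) (D.final-sorted D≡Qp 1+Q≡2m)
      where
      module D = Dynamics π m (+ m) H (+≤+ z≤n) (λ _ → +≤+ z≤n) H-antitone H-halves H-last (half-steps X) lower upper

      D≡Qp : DOf p k ≡ (2 * m ∸ 1) * p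
      D≡Qp = ℕₚ.*-comm p (2 * m ∸ 1)

      1+Q≡2m : suc (2 * m ∸ 1) ≡ m + m
      1+Q≡2m = trans (ℕₚ.suc-pred (2 * m) {{ℕ.>-nonZero (ℕₚ.≤-trans 0<m (ℕₚ.m≤m+n m _))}}) b≡m+m

-- 2-flat sequences as folded arrays

module _ (d : ℕ) {{_ : NonZero d}} where

  private
    instance
      pos : ℤ.Positive (+ d)
      pos = ℤ.positive (+<+ (ℕ.>-nonZero⁻¹ d))

  cancel-< : ∀ a a′ → a ℤ.* + d <ℤ ℤ.suc a′ ℤ.* + d → a ≤ℤ a′
  cancel-< a a′ lt = ≤-by (ℤₚ.i<j⇒suc[i]≤j (ℤₚ.*-cancelʳ-<-nonNeg {a} {ℤ.suc a′} (+ d) lt)) (eq a a′)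
    where
    eq : ∀ a a′ → (1ℤ ℤ.+ a′) ℤ.- (1ℤ ℤ.+ a) ≡ a′ ℤ.- a
    eq = ℤ-Solver.solve-∀

  floor-greatest : ∀ {a x} → a ℤ.* + d ≤ℤ x → a ≤ℤ x /ℕ d
  floor-greatest {a} {x} le = cancel-< a (x /ℕ d) (ℤₚ.≤-<-trans le (n<s[n/ℕd]*d x d))

  floor-least : ∀ {a x} → x <ℤ ℤ.suc a ℤ.* + d → x /ℕ d ≤ℤ a
  floor-least {a} {x} lt = cancel-< (x /ℕ d) a (ℤₚ.≤-<-trans ([n/ℕd]*d≤n x d) lt)

  floor-unique : ∀ {a x} → a ℤ.* + d ≤ℤ x → x <ℤ ℤ.suc a ℤ.* + d → x /ℕ d ≡ a
  floor-unique le lt = ℤₚ.≤-antisym (floor-least lt) (floor-greatest le)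

  floor-mono : ∀ {x y} → x ≤ℤ y → x /ℕ d ≤ℤ y /ℕ d
  floor-mono {x} x≤y = floor-greatest (ℤₚ.≤-trans ([n/ℕd]*d≤n x d) x≤y)

  floor-shift : ∀ x e → (x ℤ.+ e ℤ.* + d) /ℕ d ≡ x /ℕ d ℤ.+ e
  floor-shift x e = floor-unique
    (subst (_≤ℤ x ℤ.+ e ℤ.* + d) (sym (eq₁ (x /ℕ d) e (+ d))) (ℤₚ.+-monoˡ-≤ _ ([n/ℕd]*d≤n x d)))
    (subst (x ℤ.+ e ℤ.* + d <ℤ_) (sym (eq₂ (x /ℕ d) e (+ d))) (ℤₚ.+-monoˡ-< _ (n<s[n/ℕd]*d x d)))
    where
    eq₁ : ∀ q e d → (q ℤ.+ e) ℤ.* d ≡ q ℤ.* d ℤ.+ e ℤ.* d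
    eq₁ = ℤ-Solver.solve-∀
    eq₂ : ∀ q e d → (1ℤ ℤ.+ (q ℤ.+ e)) ℤ.* d ≡ (1ℤ ℤ.+ q) ℤ.* d ℤ.+ e ℤ.* d
    eq₂ = ℤ-Solver.solve-∀

≤-or-suc : ∀ {x y} → x ≤ℤ y → y ≤ℤ x ℤ.+ 1ℤ → (y ≡ x) ⊎ (y ≡ x ℤ.+ 1ℤ)
≤-or-suc {x} {y} x≤y y≤x+1 with x ℤₚ.≟ y
... | yes x≡y = inj₁ (sym x≡y)
... | no  x≢y = inj₂ (ℤₚ.≤-antisym y≤x+1
      (subst (_≤ℤ y) (ℤₚ.+-comm 1ℤ x) (ℤₚ.i<j⇒suc[i]≤j (ℤₚ.≤∧≢⇒< x≤y x≢y))))

-- The relation `x = ⌊z / m⌋` as two linear inequalities.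
IsFloor : ℕ → ℤ → ℤ → Set
IsFloor m z x = (x ℤ.* + m ≤ℤ z) × (z ℤ.+ 1ℤ ≤ℤ x ℤ.* + m ℤ.+ + m)

Floors : ℕ → Seq → ℤ → Set
Floors m a L = ∀ {i} → 1 ≤ i → i ≤ m → IsFloor m (L ℤ.+ + i) (a i)

-- Flat sequences as sequences of floors

module _ {m : ℕ} (0<m : 0 < m) {a : Seq} (flat : Flat m a) where

  flat-mono : ∀ {i j} → 1 ≤ i → i ≤ j → j ≤ m → a i ≤ℤ a j
  flat-mono {i} {zero}  1≤i i≤j j≤m = ⊥-elim (ℕₚ.<⇒≱ 1≤i i≤j)
  flat-mono {i} {suc j} 1≤i i≤j j≤m with ℕₚ.m≤n⇒m<n∨m≡n i≤j
  ... | inj₂ refl = ℤₚ.≤-refl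
  ... | inj₁ i<1+j = ℤₚ.≤-trans (flat-mono 1≤i (ℕ.s≤s⁻¹ i<1+j) (ℕₚ.<⇒≤ j≤m))
          (proj₁ flat j (ℕₚ.≤-trans 1≤i (ℕ.s≤s⁻¹ i<1+j)) j≤m)

  -- A flat sequence rises at most once, and then by 1; `n` is the last index, up to `l`, before the
  -- rise.
  threshold : ∀ l → l ≤ m → ∃[ n ] n ≤ l × (∀ {i} → 1 ≤ i → i ≤ n → a i ≡ a 1)
                                    × (∀ {i} → n < i → i ≤ l → a i ≡ a 1 ℤ.+ 1ℤ)
  threshold zero l≤m = 0 , z≤n , (λ 1≤i i≤0 → ⊥-elim (ℕₚ.<⇒≱ 1≤i i≤0)) , (λ 0<i i≤0 → ⊥-elim (ℕₚ.<⇒≱ 0<i i≤0))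
  threshold (suc l) l<m with threshold l (ℕₚ.<⇒≤ l<m)
    | ≤-or-suc (flat-mono (s≤s z≤n) (s≤s z≤n) l<m) (ℤₚ.≤-trans (flat-mono (s≤s z≤n) l<m ℕₚ.≤-refl) (proj₂ flat))
  ... | _ | inj₁ eq = suc l , ℕₚ.≤-refl ,
        (λ 1≤i i≤ → ℤₚ.≤-antisym (subst (a _ ≤ℤ_) eq (flat-mono 1≤i i≤ l<m)) (flat-mono ℕₚ.≤-refl 1≤i (ℕₚ.≤-trans i≤ l<m))) ,
        (λ l<i i≤l → ⊥-elim (ℕₚ.<⇒≱ l<i i≤l))
  ... | n , n≤l , low , high | inj₂ eq = n , ℕₚ.m≤n⇒m≤1+n n≤l , low , high′
    where
    high′ : ∀ {i} → n < i → i ≤ suc l → a i ≡ a 1 ℤ.+ 1ℤ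
    high′ n<i i≤ with ℕₚ.m≤n⇒m<n∨m≡n i≤
    ... | inj₁ i<1+l = high n<i (ℕ.s≤s⁻¹ i<1+l)
    ... | inj₂ refl  = eq

  floors : ∃[ L ] Floors m a L
  floors with threshold m ℕₚ.≤-refl
  ... | n , n≤m , low , high = L , bounds
    where
    L : ℤ
    -- Chosen so that `L + n + 1 = (a 1 + 1) * m`: the floor jumps right after index `n`.
    L = a 1 ℤ.* + m ℤ.+ + m ℤ.- 1ℤ ℤ.- + n
    eq₁ : ∀ x m n i → (m ℤ.+ i) ℤ.- (n ℤ.+ 1ℤ) ≡ (x ℤ.* m ℤ.+ m ℤ.- 1ℤ ℤ.- n ℤ.+ i) ℤ.- x ℤ.* m
    eq₁ = ℤ-Solver.solve-∀
    eq₂ : ∀ x m n i → n ℤ.- i ≡ (x ℤ.* m ℤ.+ m) ℤ.- (x ℤ.* m ℤ.+ m ℤ.- 1ℤ ℤ.- n ℤ.+ i ℤ.+ 1ℤ)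
    eq₂ = ℤ-Solver.solve-∀
    eq₃ : ∀ x m n i → i ℤ.- (1ℤ ℤ.+ n) ≡ (x ℤ.* m ℤ.+ m ℤ.- 1ℤ ℤ.- n ℤ.+ i) ℤ.- (x ℤ.+ 1ℤ) ℤ.* m
    eq₃ = ℤ-Solver.solve-∀
    eq₄ : ∀ x m n i → (m ℤ.+ n) ℤ.- (i ℤ.+ 0ℤ) ≡ ((x ℤ.+ 1ℤ) ℤ.* m ℤ.+ m) ℤ.- (x ℤ.* m ℤ.+ m ℤ.- 1ℤ ℤ.- n ℤ.+ i ℤ.+ 1ℤ)
    eq₄ = ℤ-Solver.solve-∀

    bounds : Floors m a L
    bounds {i} 1≤i i≤m with i ℕₚ.≤? n
    ... | yes i≤n = subst (IsFloor m (L ℤ.+ + i)) (sym (low 1≤i i≤n))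
      (≤-by (+≤+ (ℕₚ.+-mono-≤ n≤m 1≤i)) (eq₁ (a 1) (+ m) (+ n) (+ i)) ,
       ≤-by (+≤+ i≤n) (eq₂ (a 1) (+ m) (+ n) (+ i)))
    ... | no i≰n = subst (IsFloor m (L ℤ.+ + i)) (sym (high (ℕₚ.≰⇒> i≰n) i≤m))
      (≤-by (+≤+ (ℕₚ.≰⇒> i≰n)) (eq₃ (a 1) (+ m) (+ n) (+ i)) ,
       ≤-by (+≤+ (ℕₚ.+-mono-≤ i≤m z≤n)) (eq₄ (a 1) (+ m) (+ n) (+ i)))

module _ {m : ℕ} (0<m : 0 < m) (a : Seq) (L : ℤ) (floor : Floors m a L) where

  offset-lower : 0ℤ ≤ℤ a 1 → - 1ℤ ≤ℤ L
  offset-lower 0≤a = ≤-by (ℤₚ.≤-trans (ℤₚ.*-monoʳ-≤-nonNeg (+ m) 0≤a) (proj₁ (floor ℕₚ.≤-refl 0<m))) (eq L)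
    where
    eq : ∀ L → (L ℤ.+ 1ℤ) ℤ.- 0ℤ ≡ L ℤ.- (- 1ℤ)
    eq = ℤ-Solver.solve-∀

  offset-upper : ∀ {M} → a m ≤ℤ + M → L ℤ.+ 1ℤ ≤ℤ + (m * M)
  offset-upper {M} a≤M = ≤-by (ℤₚ.≤-trans (proj₂ (floor 0<m ℕₚ.≤-refl))
      (ℤₚ.+-monoˡ-≤ (+ m) (ℤₚ.*-monoʳ-≤-nonNeg (+ m) a≤M)))
    (trans (eq L (+ m) (+ M)) (cong (ℤ._- (L ℤ.+ 1ℤ)) (sym (ℤₚ.pos-* m M))))
    where
    eq : ∀ L m M → (M ℤ.* m ℤ.+ m) ℤ.- (L ℤ.+ m ℤ.+ 1ℤ) ≡ m ℤ.* M ℤ.- (L ℤ.+ 1ℤ)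
    eq = ℤ-Solver.solve-∀

-- The initial half array

data Parity : ℕ → Set where
  even : ∀ u → Parity (2 * u)
  odd  : ∀ u → Parity (1 + 2 * u)

parity : ∀ i → Parity i
parity zero = even 0
parity (suc i) with parity i
... | even u = odd u
... | odd u  = subst Parity (ℕₚ.*-suc 2 u) (even (suc u))

-- At 0-based index i: twice the numerator (L + j or L′ + j) of the floor giving column i + 1.
interleave : ℤ → ℤ → ℕ → ℤ
interleave L L′ zero          = (L ℤ.+ 1ℤ) ℤ.+ (L ℤ.+ 1ℤ)
interleave L L′ (suc zero)    = (L′ ℤ.+ 1ℤ) ℤ.+ (L′ ℤ.+ 1ℤ)
interleave L L′ (suc (suc i)) = interleave L L′ i ℤ.+ + 2

private
  double-suc : ∀ L x → (L ℤ.+ x) ℤ.+ (L ℤ.+ x) ℤ.+ + 2 ≡ (L ℤ.+ (1ℤ ℤ.+ x)) ℤ.+ (L ℤ.+ (1ℤ ℤ.+ x))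
  double-suc = ℤ-Solver.solve-∀

interleave-even : ∀ L L′ u → interleave L L′ (2 * u) ≡ (L ℤ.+ + suc u) ℤ.+ (L ℤ.+ + suc u)
interleave-even L L′ zero    = refl
interleave-even L L′ (suc u) = trans (cong (interleave L L′) (ℕₚ.*-suc 2 u))
  (trans (cong (ℤ._+ + 2) (interleave-even L L′ u)) (double-suc L (+ suc u)))

interleave-odd : ∀ L L′ u → interleave L L′ (1 + 2 * u) ≡ (L′ ℤ.+ + suc u) ℤ.+ (L′ ℤ.+ + suc u)
interleave-odd L L′ zero    = refl
interleave-odd L L′ (suc u) = trans (cong (λ i → interleave L L′ (suc i)) (ℕₚ.*-suc 2 u))
  (trans (cong (ℤ._+ + 2) (interleave-odd L L′ u)) (double-suc L′ (+ suc u)))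

module Start (m : ℕ) {{_ : NonZero m}} (L L′ : ℤ) where

  -- Mirrored columns have the doubled numerators `2 (L + u + 1)` and `2 (L′ + m - u)`, or the same
  -- with `L` and `L′` exchanged. Their sum is `2 S`, so subtracting `S` makes them opposite.
  S : ℤ
  S = L ℤ.+ L′ ℤ.+ + m ℤ.+ 1ℤ

  private
    instance
      2*m≢0 : NonZero (2 * m)
      2*m≢0 = ℕₚ.m*n≢0 2 m

  φ : ℤ → ℤ
  φ x = (x ℤ.+ S) /ℕ (2 * m)

  X₀ : Seq
  X₀ i = interleave L L′ i ℤ.- S

  private
    2*m : + (2 * m) ≡ + 2 ℤ.* + m
    2*m = ℤₚ.pos-* 2 m

  φ-mono : ∀ {x y} → x ≤ℤ y → φ x ≤ℤ φ y
  φ-mono x≤y = floor-mono (2 * m) (ℤₚ.+-monoˡ-≤ S x≤y)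

  φ-shift : ∀ x d → φ (x ℤ.+ (+ (m * d) ℤ.+ + (m * d))) ≡ φ x ℤ.+ + d
  φ-shift x d = trans (cong (_/ℕ (2 * m)) eq′) (floor-shift (2 * m) (x ℤ.+ S) (+ d))
    where
    eq : ∀ x S m d → (x ℤ.+ (m ℤ.* d ℤ.+ m ℤ.* d)) ℤ.+ S ≡ (x ℤ.+ S) ℤ.+ d ℤ.* (+ 2 ℤ.* m)
    eq = ℤ-Solver.solve-∀
    eq′ : (x ℤ.+ (+ (m * d) ℤ.+ + (m * d))) ℤ.+ S ≡ (x ℤ.+ S) ℤ.+ + d ℤ.* + (2 * m)
    eq′ = trans (cong (λ y → (x ℤ.+ (y ℤ.+ y)) ℤ.+ S) (ℤₚ.pos-* m d))
      (trans (eq x S (+ m) (+ d)) (cong (λ y → (x ℤ.+ S) ℤ.+ + d ℤ.* y) (sym 2*m)))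

  -- Doubling numerator and denominator does not change the floor; it is done so that the centre of
  -- symmetry `S` is an integer.
  φ-half : ∀ x z {y} → IsFloor m z y → x ℤ.+ S ≡ z ℤ.+ z → y ≡ φ x
  φ-half x z {y} (lo , hi) x+S≡ = trans
    (sym (floor-unique (2 * m) {y} {z ℤ.+ z}
      (≤-by (ℤₚ.+-mono-≤ lo lo) (trans (eq₁ y (+ m) z) (cong (λ d → (z ℤ.+ z) ℤ.- y ℤ.* d) (sym 2*m))))
      (ℤₚ.suc[i]≤j⇒i<j (ℤₚ.≤-trans (ℤₚ.i≤suc[i] _)
        (≤-by (ℤₚ.+-mono-≤ hi hi) (trans (eq₂ y (+ m) z)
          (cong (λ d → (1ℤ ℤ.+ y) ℤ.* d ℤ.- (1ℤ ℤ.+ (1ℤ ℤ.+ (z ℤ.+ z)))) (sym 2*m))))))))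
    (cong (_/ℕ (2 * m)) (sym x+S≡))
    where
    eq₁ : ∀ y m z → (z ℤ.+ z) ℤ.- (y ℤ.* m ℤ.+ y ℤ.* m) ≡ (z ℤ.+ z) ℤ.- y ℤ.* (+ 2 ℤ.* m)
    eq₁ = ℤ-Solver.solve-∀
    eq₂ : ∀ y m z → ((y ℤ.* m ℤ.+ m) ℤ.+ (y ℤ.* m ℤ.+ m)) ℤ.- ((z ℤ.+ 1ℤ) ℤ.+ (z ℤ.+ 1ℤ))
                  ≡ (1ℤ ℤ.+ y) ℤ.* (+ 2 ℤ.* m) ℤ.- (1ℤ ℤ.+ (1ℤ ℤ.+ (z ℤ.+ z)))
    eq₂ = ℤ-Solver.solve-∀

  private
    cancel-S : ∀ w S → (w ℤ.- S) ℤ.+ S ≡ w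
    cancel-S = ℤ-Solver.solve-∀

    half< : ∀ {u} → 2 * u < m → suc u ≤ m
    half< 2u<m = ℕₚ.≤-<-trans (ℕₚ.m≤m+n _ _) 2u<m

    pos-∸ : ∀ {u} → u ≤ m → + (m ∸ u) ≡ + m ℤ.- + u
    pos-∸ {u} u≤m = trans (sym (ℤₚ.⊖-≥ u≤m)) (sym (ℤₚ.m-n≡m⊖n m u))

  module _ {c : Seq}
    (odds : Floors m (λ i → c (2 * i ∸ 1)) L) (evens : Floors m (λ i → c (2 * i)) L′)
    where

    folded-X₀ : ∀ {i} → i < m → (c (suc i) ≡ φ (X₀ i)) × (c (2 * m ∸ i) ≡ φ (- X₀ i))
    folded-X₀ {i} i<m with parity i
    ... | even u = φ-half (X₀ (2 * u)) (L ℤ.+ + suc u) (subst (λ t → IsFloor m (L ℤ.+ + suc u) (c t)) (cong ℕ.pred (ℕₚ.*-suc 2 u)) (odds (s≤s z≤n) u<m))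
                     (trans (cancel-S (interleave L L′ (2 * u)) S) (interleave-even L L′ u)) ,
                   φ-half (- X₀ (2 * u)) (L′ ℤ.+ + (m ∸ u)) (subst (λ t → IsFloor m (L′ ℤ.+ + (m ∸ u)) (c t)) (ℕₚ.*-distribˡ-∸ 2 m u) (evens (ℕₚ.m<n⇒0<n∸m u<m) (ℕₚ.m∸n≤m m u)))
                     (trans (cong (λ w → - (w ℤ.- S) ℤ.+ S) (interleave-even L L′ u))
                       (trans (eq L L′ (+ m) (+ u)) (cong (λ v → (L′ ℤ.+ v) ℤ.+ (L′ ℤ.+ v)) (sym (pos-∸ (ℕₚ.<⇒≤ u<m))))))
      where
      u<m = half< i<m
      eq : ∀ L L′ m u → - (((L ℤ.+ (1ℤ ℤ.+ u)) ℤ.+ (L ℤ.+ (1ℤ ℤ.+ u))) ℤ.- (L ℤ.+ L′ ℤ.+ m ℤ.+ 1ℤ)) ℤ.+ (L ℤ.+ L′ ℤ.+ m ℤ.+ 1ℤ)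
                      ≡ (L′ ℤ.+ (m ℤ.- u)) ℤ.+ (L′ ℤ.+ (m ℤ.- u))
      eq = ℤ-Solver.solve-∀
    ... | odd u = φ-half (X₀ (1 + 2 * u)) (L′ ℤ.+ + suc u) (subst (λ t → IsFloor m (L′ ℤ.+ + suc u) (c t)) (ℕₚ.*-suc 2 u) (evens (s≤s z≤n) u<m))
                    (trans (cancel-S (interleave L L′ (1 + 2 * u)) S) (interleave-odd L L′ u)) ,
                  φ-half (- X₀ (1 + 2 * u)) (L ℤ.+ + (m ∸ u)) (subst (λ t → IsFloor m (L ℤ.+ + (m ∸ u)) (c t)) index (odds (ℕₚ.m<n⇒0<n∸m u<m) (ℕₚ.m∸n≤m m u)))
                    (trans (cong (λ w → - (w ℤ.- S) ℤ.+ S) (interleave-odd L L′ u))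
                      (trans (eq L L′ (+ m) (+ u)) (cong (λ v → (L ℤ.+ v) ℤ.+ (L ℤ.+ v)) (sym (pos-∸ (ℕₚ.<⇒≤ u<m))))))
      where
      u<m = half< (ℕₚ.<⇒≤ i<m)
      index : 2 * (m ∸ u) ∸ 1 ≡ 2 * m ∸ (1 + 2 * u)
      index = trans (cong (_∸ 1) (ℕₚ.*-distribˡ-∸ 2 m u))
        (trans (ℕₚ.∸-+-assoc (2 * m) (2 * u) 1) (cong (2 * m ∸_) (ℕₚ.+-comm (2 * u) 1)))
      eq : ∀ L L′ m u → - (((L′ ℤ.+ (1ℤ ℤ.+ u)) ℤ.+ (L′ ℤ.+ (1ℤ ℤ.+ u))) ℤ.- (L ℤ.+ L′ ℤ.+ m ℤ.+ 1ℤ)) ℤ.+ (L ℤ.+ L′ ℤ.+ m ℤ.+ 1ℤ)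
                      ≡ (L ℤ.+ (m ℤ.- u)) ℤ.+ (L ℤ.+ (m ℤ.- u))
      eq = ℤ-Solver.solve-∀

  module _ {α : ℤ} where

    private
      -- The difference equals `A - B + 2u + 1 - m`; here `A ≥ - 1` and `B ≤ α - 1`.
      gap-lower : ∀ A B u → S ≡ A ℤ.+ B ℤ.+ + m ℤ.+ 1ℤ → - 1ℤ ≤ℤ A → B ℤ.+ 1ℤ ≤ℤ α →
                  - α ℤ.- (+ m ℤ.+ + m) ≤ℤ (A ℤ.+ + suc u) ℤ.+ (A ℤ.+ + suc u) ℤ.- S
      gap-lower A B u S≡ -1≤A B+1≤α rewrite S≡ =
        ≤-by (ℤₚ.+-mono-≤ -1≤A (ℤₚ.+-mono-≤ B+1≤α (+≤+ (z≤n {1 + (u + u) + m})))) (eq A B (+ m) (+ u) α)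
        where
        eq : ∀ A B m u α → (A ℤ.+ (α ℤ.+ (1ℤ ℤ.+ (u ℤ.+ u) ℤ.+ m))) ℤ.- (- 1ℤ ℤ.+ ((B ℤ.+ 1ℤ) ℤ.+ 0ℤ))
           ≡ ((A ℤ.+ (1ℤ ℤ.+ u)) ℤ.+ (A ℤ.+ (1ℤ ℤ.+ u)) ℤ.- (A ℤ.+ B ℤ.+ m ℤ.+ 1ℤ)) ℤ.- (- α ℤ.- (m ℤ.+ m))
        eq = ℤ-Solver.solve-∀

      gap-upper : ∀ A B u → S ≡ A ℤ.+ B ℤ.+ + m ℤ.+ 1ℤ → A ℤ.+ 1ℤ ≤ℤ α → - 1ℤ ≤ℤ B → 1 + 2 * u ≤ m →
                  (A ℤ.+ + suc u) ℤ.+ (A ℤ.+ + suc u) ℤ.- S ≤ℤ α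
      gap-upper A B u S≡ A+1≤α -1≤B u< rewrite S≡ =
        ≤-by (ℤₚ.+-mono-≤ A+1≤α (ℤₚ.+-mono-≤ -1≤B (+≤+ (subst (λ v → 1 + (u + v) ≤ m) (ℕₚ.+-identityʳ u) u<))))
          (eq A B (+ m) (+ u) α)
        where
        eq : ∀ A B m u α → (α ℤ.+ (B ℤ.+ m)) ℤ.- ((A ℤ.+ 1ℤ) ℤ.+ (- 1ℤ ℤ.+ (1ℤ ℤ.+ (u ℤ.+ u))))
           ≡ α ℤ.- ((A ℤ.+ (1ℤ ℤ.+ u)) ℤ.+ (A ℤ.+ (1ℤ ℤ.+ u)) ℤ.- (A ℤ.+ B ℤ.+ m ℤ.+ 1ℤ))
        eq = ℤ-Solver.solve-∀

      S-comm : S ≡ L′ ℤ.+ L ℤ.+ + m ℤ.+ 1ℤ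
      S-comm = cong (λ x → x ℤ.+ + m ℤ.+ 1ℤ) (ℤₚ.+-comm L L′)

    module _ (-1≤L : - 1ℤ ≤ℤ L) (L+1≤α : L ℤ.+ 1ℤ ≤ℤ α) (-1≤L′ : - 1ℤ ≤ℤ L′) (L′+1≤α : L′ ℤ.+ 1ℤ ≤ℤ α) where

      X₀-lower : ∀ {i} → i < m → - α ℤ.- (+ m ℤ.+ + m) ≤ℤ X₀ i
      X₀-lower {i} i<m with parity i
      ... | even u rewrite interleave-even L L′ u = gap-lower L L′ u refl -1≤L L′+1≤α
      ... | odd u  rewrite interleave-odd L L′ u  = gap-lower L′ L u S-comm -1≤L′ L+1≤α

      X₀-upper : ∀ {i} → i < m → X₀ i ≤ℤ α
      X₀-upper {i} i<m with parity i
      ... | even u rewrite interleave-even L L′ u = gap-upper L L′ u refl L+1≤α -1≤L′ i<m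
      ... | odd u  rewrite interleave-odd L L′ u  = gap-upper L′ L u S-comm L′+1≤α -1≤L (ℕₚ.<⇒≤ i<m)

theorem3p43 : (p k : ℕ) → 4 ≤ p → p ≤ k → (c : Seq)
    → (∀ t → 1 ≤ t → t ≤ bOf p k → (+ 0 ≤ℤ c t) × (c t ≤ℤ + (2 ^ (k ∸ 1) ∸ 1)))
    → TwoFlat (bOf p k) c
    → Flat (bOf p k) (f p k c)
theorem3p43 _ k (s≤s (s≤s (s≤s (s≤s {n = π} z≤n)))) p≤k c range twoFlat =
  flat-f φ (λ x≤y → φ-mono x≤y) φ-shift {c} {X₀} (folded-X₀ {c} odds evens)
    (X₀-lower -1≤L L+1≤α -1≤L′ L′+1≤α) (X₀-upper -1≤L L+1≤α -1≤L′ L′+1≤α)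
  where
  open Reduction π k p≤k

  instance
    m≢0 : NonZero m
    m≢0 = ℕ.>-nonZero 0<m

  oddCols evenCols : Seq
  oddCols i  = c (2 * i ∸ 1)
  evenCols i = c (2 * i)

  oddFlat : Flat m oddCols
  oddFlat = subst (λ l → Flat l oddCols) b/2≡m (proj₁ twoFlat)

  evenFlat : Flat m evenCols
  evenFlat = subst (λ l → Flat l evenCols) b/2≡m (proj₂ twoFlat)

  L L′ : ℤ
  L  = proj₁ (floors 0<m oddFlat)
  L′ = proj₁ (floors 0<m evenFlat)

  odds : Floors m oddCols L
  odds = proj₂ (floors 0<m oddFlat)

  evens : Floors m evenCols L′
  evens = proj₂ (floors 0<m evenFlat)

  2≤b : 2 ≤ 2 * m
  2≤b = ℕₚ.*-monoʳ-≤ 2 0<m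

  1≤b : 1 ≤ 2 * m
  1≤b = ℕₚ.<⇒≤ 2≤b

  -1≤L : - 1ℤ ≤ℤ L
  -1≤L = offset-lower 0<m oddCols L odds (proj₁ (range 1 (s≤s z≤n) 1≤b))

  -1≤L′ : - 1ℤ ≤ℤ L′
  -1≤L′ = offset-lower 0<m evenCols L′ evens (proj₁ (range 2 (s≤s z≤n) 2≤b))

  L+1≤α : L ℤ.+ 1ℤ ≤ℤ H 0
  -- The top of the range, `2 ^ (k - 1) - 1`, is `h_0`, so the bound `m * h_0` on `L + 1` is `H 0`.
  L+1≤α = offset-upper 0<m oddCols L odds (proj₂ (range (2 * m ∸ 1) (ℕₚ.∸-monoˡ-≤ 1 2≤b) (ℕₚ.m∸n≤m _ 1)))

  L′+1≤α : L′ ℤ.+ 1ℤ ≤ℤ H 0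
  L′+1≤α = offset-upper 0<m evenCols L′ evens (proj₂ (range (2 * m) 1≤b ℕₚ.≤-refl))

  open Start m L L′
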